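{- Let $M$ be an acyclic oriented matroid represented over $\mathbb{R}$ by a finite (multi)set of vectors $E\subset\mathbb{R}^n$. The number of transitive $2$-colorings of $M$ is equal to the number of chambers in the dual hyperplane arrangement.
   Context: The signed circuits of the oriented matroid represented by $E$ are the pairs $(X^+,X^-)$ given by the signs of the coefficients of the linear dependencies among $E$ with inclusion-minimal nonempty support. It is acyclic if it has no signed circuit with $X^-=\varnothing$ (equivalently, no nontrivial nonnegative linear combination of vectors of $E$ is $0$). A transitive $2$-coloring of $M$ is a function $\varepsilon$ from $E$ to a 2-element set of colors such that $\varepsilon(X^+)\cap\varepsilon(X^-)\ne\varnothing$ for every signed circuit $(X^+,X^-)$. The dual hyperplane arrangement consists of the hyperplanes $\{x\in\mathbb{R}^n: x^t e=0\}$, $e\in E$; its chambers are the connected components of the complement in $\mathbb{R}^n$ of the union of these hyperplanes. -}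

module Defs where

open import Level using (0ℓ) renaming (suc to lsuc)
open import Algebra.Bundles using (CommutativeRing)
open import Algebra.Definitions using (Invertible)
import Algebra.Properties.CommutativeMonoid.Sum as CommutativeMonoidSum
open import Data.Fin.Base using (Fin)
open import Data.Fin.Subset using (Subset) renaming (_∈_ to _∈ₛ_; ⊥ to ∅ₛ)
open import Data.Nat.Base using (ℕ)
open import Data.Product.Base using (∃-syntax; _×_; proj₁)
open import Data.Vec.Functional using (Vector)
open import Function.Bundles using (Inverse; _⇔_)
open import Relation.Binary.Bundles using (Setoid)
open import Relation.Binary.Core using (Rel; REL)
open import Relation.Binary.Structures using (IsStrictTotalOrder)
import Relation.Binary.Construct.On as On
import Relation.Binary.Construct.StrictToNonStrict as StrictToNonStrict
open import Relation.Binary.PropositionalEquality using (_≡_; setoid; _→-setoid_)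
open import Relation.Nullary.Negation using (¬_)
open import Relation.Unary
  using (Pred; _∈_; _⊆_; _∩_; _∪_; _≬_; ∁; ⋃; Satisfiable)
open import Relation.Unary.Relation.Binary.Equality using (≐-setoid)

-- The usual axioms for ℝ.  Classically they determine the field up to unique
-- isomorphism.  Equality is the setoid equality of the underlying ring, since
-- there are no quotient types.
record CompleteOrderedField : Set₁ where
  infix 4 _<_ _≤_
  field
    commutativeRing : CommutativeRing 0ℓ 0ℓ

  open CommutativeRing commutativeRing public

  field
    0≉1                : 0# ≉ 1#
    invertible         : ∀ x → x ≉ 0# → Invertible _≈_ 1# _*_ x
    _<_                : Rel Carrier 0ℓ
    isStrictTotalOrder : IsStrictTotalOrder _≈_ _<_
    +-monoˡ-<          : ∀ z {x y} → x < y → x + z < y + z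
    *-pos              : ∀ {x y} → 0# < x → 0# < y → 0# < x * y

  _≤_ : Rel Carrier 0ℓ
  _≤_ = StrictToNonStrict._≤_ _≈_ _<_

  UpperBound : Pred Carrier 0ℓ → Pred Carrier 0ℓ
  UpperBound P b = ∀ x → x ∈ P → x ≤ b

  field
    supremum : ∀ (P : Pred Carrier 0ℓ) → Satisfiable P → Satisfiable (UpperBound P) →
               ∃[ s ] UpperBound P s × (∀ b → UpperBound P b → s ≤ b)

infix 4 _HasCardinality_

_HasCardinality_ : ∀ {a ℓ} → Setoid a ℓ → ℕ → Set _
S HasCardinality k = Inverse (setoid (Fin k)) S

-- 𝒞 X⁺ X⁻ says that (X⁺ , X⁻) is a signed circuit.
SignedCircuits : ℕ → Set₁
SignedCircuits m = REL (Subset m) (Subset m) 0ℓ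

module _ {m : ℕ} (𝒞 : SignedCircuits m) where

  Acyclic : Set
  Acyclic = ∀ X⁺ → ¬ 𝒞 X⁺ ∅ₛ

  Image : ∀ {c} → (Fin m → Fin c) → Subset m → Pred (Fin c) 0ℓ
  Image ε X κ = ∃[ i ] i ∈ₛ X × ε i ≡ κ

  IsTransitiveColoring : ∀ {c} → Pred (Fin m → Fin c) 0ℓ
  IsTransitiveColoring ε = ∀ X⁺ X⁻ → 𝒞 X⁺ X⁻ → Image ε X⁺ ≬ Image ε X⁻

  -- Colorings are compared pointwise, ignoring the proof of transitivity.
  TransitiveColorings : ℕ → Setoid 0ℓ 0ℓ
  TransitiveColorings c = On.setoid (Fin m →-setoid Fin c) (proj₁ {B = IsTransitiveColoring})

module OverReals (ℝ : CompleteOrderedField) where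

  open CompleteOrderedField ℝ hiding (setoid)
  open CommutativeMonoidSum +-commutativeMonoid using (sum)

  infix 8 ℝ^_
  infixl 7 _·_

  ℝ^_ : ℕ → Set
  ℝ^ n = Vector Carrier n

  _·_ : ∀ {n} → ℝ^ n → ℝ^ n → Carrier
  x · y = sum λ j → x j * y j

  -- A finite multiset of vectors is a family E indexed by Fin m; subsets of E
  -- are subsets of the index set.
  module _ {n m : ℕ} (E : Fin m → ℝ^ n) where

    LinearDependency : Pred (Vector Carrier m) 0ℓ
    LinearDependency c = ∀ j → sum (λ i → c i * E i j) ≈ 0#

    Support : Vector Carrier m → Pred (Fin m) 0ℓ
    Support c i = c i ≉ 0#

    record IsMinimalDependency (c : Vector Carrier m) : Set where
      field
        dependency : LinearDependency c
        nonempty   : Satisfiable (Support c)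
        minimal    : ∀ d → LinearDependency d → Satisfiable (Support d) →
                     Support d ⊆ Support c → Support c ⊆ Support d

    circuits : SignedCircuits m
    circuits X⁺ X⁻ = ∃[ c ] IsMinimalDependency c
                          × (∀ i → i ∈ₛ X⁺ ⇔ 0# < c i)
                          × (∀ i → i ∈ₛ X⁻ ⇔ c i < 0#)

  -- The usual topology on ℝⁿ, with open cubes around a point as basic
  -- neighbourhoods.
  Near : ∀ {n} → Carrier → ℝ^ n → ℝ^ n → Set
  Near δ x y = ∀ j → (x j < y j + δ) × (y j < x j + δ)

  Open : ∀ {n} → Pred (Pred (ℝ^ n) 0ℓ) 0ℓ
  Open U = ∀ x → x ∈ U → ∃[ δ ] 0# < δ × (∀ y → Near δ x y → y ∈ U)

  Connected : ∀ {n} → Pred (Pred (ℝ^ n) 0ℓ) (lsuc 0ℓ)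
  Connected A = ∀ U V → Open U → Open V → A ⊆ U ∪ V → A ≬ U → A ≬ V → A ≬ (U ∩ V)

  record IsConnectedComponent {n} (A C : Pred (ℝ^ n) 0ℓ) : Set₁ where
    field
      contained : C ⊆ A
      nonempty  : Satisfiable C
      connected : Connected C
      maximal   : ∀ D → D ⊆ A → Connected D → C ⊆ D → D ⊆ C

  Hyperplane : ∀ {n} → ℝ^ n → Pred (ℝ^ n) 0ℓ
  Hyperplane e x = x · e ≈ 0#

  module _ {n m : ℕ} (E : Fin m → ℝ^ n) where

    Complement : Pred (ℝ^ n) 0ℓ
    Complement = ∁ (⋃ (Fin m) λ i → Hyperplane (E i))

    -- Chambers are sets of points, compared extensionally.
    Chambers : Setoid (lsuc 0ℓ) 0ℓ
    Chambers = On.setoid (≐-setoid (ℝ^ n) 0ℓ) (proj₁ {B = IsConnectedComponent Complement})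

{-# OPTIONS --safe #-}

-- Both sides are counted by the sign patterns ε for which the cell {x : εᵢ (x · eᵢ) > 0 for all i}
-- is nonempty.  By Gordan's theorem the cell of ε is empty iff there is a nonzero dependency whose
-- coefficients agree in sign with ε; one of minimal support is a circuit with ε = 1 on X⁺ and
-- ε = -1 on X⁻, so ε is not transitive.  Conversely, a point x of the cell of ε and a circuit c
-- satisfy ∑ cᵢ (x · eᵢ) = 0, so εᵢcᵢ takes both signs; as X⁺ and X⁻ are nonempty by acyclicity,
-- they share a colour.  Finally the chambers are the nonempty cells: a cell is convex, hence
-- connected, and a connected set that misses all hyperplanes cannot leave its cell.
module Submission where

open import Defs
open import Level using (Level; 0ℓ)
open import Algebra.Bundles using (CommutativeRing)
import Algebra.Properties.AbelianGroup as AbelianGroupProperties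
import Algebra.Properties.Ring as RingProperties
import Algebra.Properties.Semiring.Mult.TCOptimised as Mult
import Algebra.Properties.Semiring.Sum as SemiringSum
import Algebra.Solver.Ring as RingSolver
open import Algebra.Solver.Ring.AlmostCommutativeRing
  using (fromCommutativeRing; _-Raw-AlmostCommutative⟶_)
open import Axiom.ExcludedMiddle using (ExcludedMiddle)
open import Data.Bool.Base using (true)
open import Data.Fin.Base using (Fin; zero; suc; finToFun; funToFin; combine)
open import Data.Fin.Patterns using (0F; 1F)
open import Data.Fin.Properties using (any?; funToFin-finToFin; finToFun-funToFin; suc-injective)
open import Data.Fin.Subset using (Subset; Nonempty; _⊂_) renaming (_∈_ to _∈ₛ_)
open import Data.Fin.Subset.Induction using (⊂-wellFounded; Acc; acc)
open import Data.Fin.Subset.Properties using (nonempty?; Empty-unique)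
open import Data.Integer.Base as ℤ using (ℤ; +_; -[1+_]; _⊖_; _◃_; 0ℤ; 1ℤ; -1ℤ)
import Data.Integer.Properties as ℤ
import Data.Maybe.Base as Maybe
open import Data.Nat.Base as ℕ using (ℕ; zero; suc; _^_)
open import Data.Nat.Properties using (+-suc)
open import Data.Product.Base using (∃; ∃-syntax; _×_; _,_; proj₁; proj₂)
open import Data.Sign.Base as Sign using (Sign)
open import Data.Sum.Base as Sum using (_⊎_; inj₁; inj₂; [_,_]′)
open import Data.Vec.Base using (tabulate)
open import Data.Vec.Functional using (Vector; _∷_)
open import Data.Vec.Properties using ([]=⇒lookup; lookup⇒[]=; lookup∘tabulate)
open import Function.Base using (_∘_; id)
open import Function.Bundles using (_⇔_; mk⇔; Equivalence; Inverse)
import Function.Construct.Composition as Composition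
open import Relation.Binary.Bundles using (Setoid)
import Relation.Binary.Construct.On as On
open import Relation.Binary.Definitions using (_Respects_; tri<; tri≈; tri>)
open import Relation.Binary.PropositionalEquality as ≡ using (_≡_; _≗_; _→-setoid_)
open import Relation.Binary.Structures using (IsStrictTotalOrder)
open import Relation.Nullary using (¬_; Dec; yes; no; does; ¬?; contradiction)
open import Relation.Nullary.Decidable using (decidable-stable; dec-true; dec⇒maybe)
open import Relation.Unary using (Pred; Decidable; Satisfiable; _⊆_; _≬_; _≐_)

-- Between Gordan's theorem and circuits lies a gap in minimality. Descending on supports yields a
-- dependency `c` that is minimal only among those whose signs conform to ε, whereas a circuit is
-- minimal among all dependencies. Elimination closes the gap: a nonzero dependency supported
-- strictly inside the support of `c` can, up to sign, be subtracted from `c` until a further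
-- coordinate vanishes, and stopping at the first such coordinate keeps all signs. So `c` would not
-- have been minimal among the conforming ones either. The order is decidable, so Gordan's theorem
-- is a finite case analysis. Excluded middle is used to descend to a minimal support, to approach a
-- supremum and to decide which cells are nonempty. Completeness enters through the supremum that
-- makes convex sets connected.

-- Ordered fields

-- With integer coefficients the solver also cancels opposite terms.
module IntegerCoefficients {c ℓ} (R : CommutativeRing c ℓ) where

  open CommutativeRing R hiding (zero)
  open RingProperties ring using (-‿distribˡ-*; -‿distribʳ-*; -‿involutive; -0#≈0#)
  open AbelianGroupProperties +-abelianGroup using (⁻¹-∙-comm)
  open Mult semiring using (×-homo-+; ×1-homo-*) renaming (_×_ to _×′_)
  open import Relation.Binary.Reasoning.Setoid setoid

  private
    -- The optimised multiple reduces `1 ×′ 1#` to `1#`, so the constants 0, 1 and -1 in solver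
    -- expressions denote literally `0#`, `1#` and `- 1#`.
    ⟦_⟧ : ℤ → Carrier
    ⟦ + n ⟧      = n ×′ 1#
    ⟦ -[1+ n ] ⟧ = - (suc n ×′ 1#)

    1+n : ∀ n → suc n ×′ 1# ≈ 1# + n ×′ 1#
    1+n n = ×-homo-+ 1# 1 n

    ⟦⊖⟧ : ∀ m n → ⟦ m ⊖ n ⟧ ≈ m ×′ 1# - n ×′ 1#
    ⟦⊖⟧ zero zero = sym (-‿inverseʳ 0#)
    ⟦⊖⟧ zero (suc n) = sym (+-identityˡ _)
    ⟦⊖⟧ (suc m) zero = sym (trans (+-congˡ -0#≈0#) (+-identityʳ _))
    ⟦⊖⟧ (suc m) (suc n) = begin
      ⟦ suc m ⊖ suc n ⟧                      ≡⟨ ≡.cong ⟦_⟧ (ℤ.[1+m]⊖[1+n]≡m⊖n m n) ⟩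
      ⟦ m ⊖ n ⟧                              ≈⟨ ⟦⊖⟧ m n ⟩
      m ×′ 1# - n ×′ 1#                        ≈⟨ +-congʳ (+-identityʳ _) ⟨
      (m ×′ 1# + 0#) - n ×′ 1#                 ≈⟨ +-congʳ (+-congˡ (-‿inverseʳ 1#)) ⟨
      (m ×′ 1# + (1# - 1#)) - n ×′ 1#          ≈⟨ +-congʳ (+-assoc _ _ _) ⟨
      ((m ×′ 1# + 1#) - 1#) - n ×′ 1#          ≈⟨ +-assoc _ _ _ ⟩
      (m ×′ 1# + 1#) + (- 1# - n ×′ 1#)        ≈⟨ +-cong (+-comm _ _) (⁻¹-∙-comm _ _) ⟩
      (1# + m ×′ 1#) - (1# + n ×′ 1#)          ≈⟨ +-cong (1+n m) (-‿cong (1+n n)) ⟨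
      suc m ×′ 1# - suc n ×′ 1#                ∎

    +-homo : ∀ i j → ⟦ i ℤ.+ j ⟧ ≈ ⟦ i ⟧ + ⟦ j ⟧
    +-homo (+ m) (+ n) = ×-homo-+ 1# m n
    +-homo (+ m) -[1+ n ] = ⟦⊖⟧ m (suc n)
    +-homo -[1+ m ] (+ n) = trans (⟦⊖⟧ n (suc m)) (+-comm _ _)
    +-homo -[1+ m ] -[1+ n ] = begin
      - (suc (suc (m ℕ.+ n)) ×′ 1#)     ≡⟨ ≡.cong (λ k → - (k ×′ 1#)) (≡.cong suc (+-suc m n)) ⟨
      - ((suc m ℕ.+ suc n) ×′ 1#)       ≈⟨ -‿cong (×-homo-+ 1# (suc m) (suc n)) ⟩
      - (suc m ×′ 1# + suc n ×′ 1#)      ≈⟨ ⁻¹-∙-comm _ _ ⟨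
      - (suc m ×′ 1#) - suc n ×′ 1#      ∎

    -‿homo : ∀ i → ⟦ ℤ.- i ⟧ ≈ - ⟦ i ⟧
    -‿homo (+ zero) = sym -0#≈0#
    -‿homo (+ suc n) = refl
    -‿homo -[1+ n ] = sym (-‿involutive _)

    -- Integer multiplication is defined through signs and absolute values, so its compatibility
    -- with `⟦_⟧` is checked on these two parts separately.
    signed : Sign → Carrier → Carrier
    signed Sign.+ x = x
    signed Sign.- x = - x

    signed-cong : ∀ s {x y} → x ≈ y → signed s x ≈ signed s y
    signed-cong Sign.+ = λ eq → eq
    signed-cong Sign.- = -‿cong

    signed-* : ∀ s t x y → signed (s Sign.* t) (x * y) ≈ signed s x * signed t y
    signed-* Sign.+ Sign.+ x y = refl
    signed-* Sign.+ Sign.- x y = -‿distribʳ-* x y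
    signed-* Sign.- Sign.+ x y = -‿distribˡ-* x y
    signed-* Sign.- Sign.- x y = begin
      x * y          ≈⟨ -‿involutive _ ⟨
      - - (x * y)    ≈⟨ -‿cong (-‿distribˡ-* x y) ⟩
      - (- x * y)    ≈⟨ -‿distribʳ-* (- x) y ⟩
      - x * - y      ∎

    ⟦◃⟧ : ∀ s n → ⟦ s ◃ n ⟧ ≈ signed s (n ×′ 1#)
    ⟦◃⟧ Sign.+ zero = refl
    ⟦◃⟧ Sign.- zero = sym -0#≈0#
    ⟦◃⟧ Sign.+ (suc n) = refl
    ⟦◃⟧ Sign.- (suc n) = refl

    signed-abs : ∀ i → signed (ℤ.sign i) (ℤ.∣ i ∣ ×′ 1#) ≈ ⟦ i ⟧
    signed-abs (+ n) = refl
    signed-abs -[1+ n ] = refl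

    *-homo : ∀ i j → ⟦ i ℤ.* j ⟧ ≈ ⟦ i ⟧ * ⟦ j ⟧
    *-homo i j = begin
      ⟦ s ◃ ℤ.∣ i ∣ ℕ.* ℤ.∣ j ∣ ⟧                                ≈⟨ ⟦◃⟧ s (ℤ.∣ i ∣ ℕ.* ℤ.∣ j ∣) ⟩
      signed s ((ℤ.∣ i ∣ ℕ.* ℤ.∣ j ∣) ×′ 1#)
        ≈⟨ signed-cong s (×1-homo-* ℤ.∣ i ∣ ℤ.∣ j ∣) ⟩
      signed s ((ℤ.∣ i ∣ ×′ 1#) * (ℤ.∣ j ∣ ×′ 1#))
        ≈⟨ signed-* (ℤ.sign i) (ℤ.sign j) _ _ ⟩
      signed (ℤ.sign i) _ * signed (ℤ.sign j) _
        ≈⟨ *-cong (signed-abs i) (signed-abs j) ⟩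
      ⟦ i ⟧ * ⟦ j ⟧                                              ∎
      where s = ℤ.sign i Sign.* ℤ.sign j

    homomorphism : ℤ.+-*-rawRing -Raw-AlmostCommutative⟶ fromCommutativeRing R
    homomorphism = record
      { ⟦_⟧ = ⟦_⟧ ; +-homo = +-homo ; *-homo = *-homo ; -‿homo = -‿homo
      ; 0-homo = refl ; 1-homo = refl }

  open RingSolver ℤ.+-*-rawRing (fromCommutativeRing R) homomorphism
    (λ i j → Maybe.map (λ i≡j → reflexive (≡.cong ⟦_⟧ i≡j)) (dec⇒maybe (i ℤ.≟ j))) public

module OrderedField (ℝ : CompleteOrderedField) where

  open CompleteOrderedField ℝ hiding (zero)
  open IsStrictTotalOrder isStrictTotalOrder public
    using (compare; _≟_; _<?_; irrefl; asym; <-respʳ-≈; <-respˡ-≈) renaming (trans to <-trans)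
  open IntegerCoefficients commutativeRing
  open SemiringSum semiring using (sum; *-distribˡ-sum)

  <⇒0<∸ : ∀ {x y} → x < y → 0# < y - x
  <⇒0<∸ {x} x<y = <-respˡ-≈ (-‿inverseʳ x) (+-monoˡ-< (- x) x<y)

  0<∸⇒< : ∀ {x y} → 0# < y - x → x < y
  0<∸⇒< {x} {y} p = <-respˡ-≈ (+-identityˡ x)
    (<-respʳ-≈ (solve 2 (λ x y → y :- x :+ x := y) refl x y) (+-monoˡ-< x p))

  0<-⇒<0 : ∀ {x} → 0# < - x → x < 0#
  0<-⇒<0 {x} p = 0<∸⇒< (<-respʳ-≈ (sym (+-identityˡ (- x))) p)

  <0⇒0<- : ∀ {x} → x < 0# → 0# < - x
  <0⇒0<- {x} p = <-respʳ-≈ (+-identityˡ (- x)) (<⇒0<∸ p)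

  +-pos : ∀ {x y} → 0# < x → 0# < y → 0# < x + y
  +-pos {x} {y} 0<x 0<y = <-trans 0<y (<-respˡ-≈ (+-identityˡ y) (+-monoˡ-< y 0<x))

  +-nonneg-pos : ∀ {x y} → 0# ≤ x → 0# < y → 0# < x + y
  +-nonneg-pos (inj₁ 0<x) 0<y = +-pos 0<x 0<y
  +-nonneg-pos (inj₂ 0≈x) 0<y = <-respʳ-≈ (trans (sym (+-identityˡ _)) (+-congʳ 0≈x)) 0<y

  +-pos-nonneg : ∀ {x y} → 0# < x → 0# ≤ y → 0# < x + y
  +-pos-nonneg 0<x 0≤y = <-respʳ-≈ (+-comm _ _) (+-nonneg-pos 0≤y 0<x)

  +-nonneg : ∀ {x y} → 0# ≤ x → 0# ≤ y → 0# ≤ x + y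
  +-nonneg 0≤x (inj₁ 0<y) = inj₁ (+-nonneg-pos 0≤x 0<y)
  +-nonneg (inj₁ 0<x) 0≤y = inj₁ (+-pos-nonneg 0<x 0≤y)
  +-nonneg (inj₂ 0≈x) (inj₂ 0≈y) = inj₂ (trans (sym (+-identityˡ 0#)) (+-cong 0≈x 0≈y))

  *-nonneg : ∀ {x y} → 0# ≤ x → 0# ≤ y → 0# ≤ x * y
  *-nonneg (inj₂ 0≈x) 0≤y = inj₂ (trans (sym (zeroˡ _)) (*-congʳ 0≈x))
  *-nonneg 0≤x (inj₂ 0≈y) = inj₂ (trans (sym (zeroʳ _)) (*-congˡ 0≈y))
  *-nonneg (inj₁ 0<x) (inj₁ 0<y) = inj₁ (*-pos 0<x 0<y)

  ≤-resp : ∀ {x y} → x ≈ y → 0# ≤ x → 0# ≤ y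
  ≤-resp x≈y (inj₁ 0<x) = inj₁ (<-respʳ-≈ x≈y 0<x)
  ≤-resp x≈y (inj₂ 0≈x) = inj₂ (trans 0≈x x≈y)

  ≮⇒≥ : ∀ {x y} → ¬ x < y → y ≤ x
  ≮⇒≥ {x} {y} x≮y with compare x y
  ... | tri< x<y _ _ = contradiction x<y x≮y
  ... | tri≈ _ x≈y _ = inj₂ (sym x≈y)
  ... | tri> _ _ y<x = inj₁ y<x

  ≤⇒≯ : ∀ {x y} → x ≤ y → ¬ y < x
  ≤⇒≯ (inj₁ x<y) y<x = asym x<y y<x
  ≤⇒≯ (inj₂ x≈y) y<x = irrefl (sym x≈y) y<x

  <-≤-trans : ∀ {x y z} → x < y → y ≤ z → x < z
  <-≤-trans x<y (inj₁ y<z) = <-trans x<y y<z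
  <-≤-trans x<y (inj₂ y≈z) = <-respʳ-≈ y≈z x<y

  ≤⇒0≤∸ : ∀ {x y} → x ≤ y → 0# ≤ y - x
  ≤⇒0≤∸ (inj₁ x<y) = inj₁ (<⇒0<∸ x<y)
  ≤⇒0≤∸ {x} (inj₂ x≈y) = inj₂ (trans (sym (-‿inverseʳ x)) (+-congʳ x≈y))

  0<1 : 0# < 1#
  0<1 with compare 0# 1#
  ... | tri< 0<1 _ _ = 0<1
  ... | tri≈ _ 0≈1 _ = contradiction 0≈1 0≉1
  ... | tri> _ _ 1<0 = contradiction
    (<-respʳ-≈ (solve 0 (:- con 1ℤ :* :- con 1ℤ := con 1ℤ) refl) (*-pos (<0⇒0<- 1<0) (<0⇒0<- 1<0)))
    (asym 1<0)

  pos⇒≉0 : ∀ {x} → 0# < x → x ≉ 0#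
  pos⇒≉0 0<x x≈0 = irrefl (sym x≈0) 0<x

  neg⇒≉0 : ∀ {x} → x < 0# → x ≉ 0#
  neg⇒≉0 x<0 x≈0 = irrefl x≈0 x<0

  ≥0∧≉0⇒pos : ∀ {x} → 0# ≤ x → x ≉ 0# → 0# < x
  ≥0∧≉0⇒pos (inj₁ 0<x) _ = 0<x
  ≥0∧≉0⇒pos (inj₂ 0≈x) x≉0 = contradiction (sym 0≈x) x≉0

  neg-* : ∀ {x y} → x < 0# → y < 0# → 0# < x * y
  neg-* {x} {y} x<0 y<0 = <-respʳ-≈ (solve 2 (λ x y → :- x :* :- y := x :* y) refl x y)
    (*-pos (<0⇒0<- x<0) (<0⇒0<- y<0))

  pos-*-neg : ∀ {x y} → 0# < x → y < 0# → x * y < 0#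
  pos-*-neg {x} {y} 0<x y<0 = 0<-⇒<0
    (<-respʳ-≈ (solve 2 (λ x y → x :* :- y := :- (x :* y)) refl x y) (*-pos 0<x (<0⇒0<- y<0)))

  *-≉0 : ∀ {x y} → x ≉ 0# → y ≉ 0# → x * y ≉ 0#
  *-≉0 {x} {y} x≉0 y≉0 with compare 0# x | compare 0# y
  ... | tri≈ _ 0≈x _ | _            = contradiction (sym 0≈x) x≉0
  ... | _            | tri≈ _ 0≈y _ = contradiction (sym 0≈y) y≉0
  ... | tri< 0<x _ _ | tri< 0<y _ _ = pos⇒≉0 (*-pos 0<x 0<y)
  ... | tri< 0<x _ _ | tri> _ _ y<0 = neg⇒≉0 (pos-*-neg 0<x y<0)
  ... | tri> _ _ x<0 | tri< 0<y _ _ = neg⇒≉0 (<-respˡ-≈ (*-comm _ _) (pos-*-neg 0<y x<0))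
  ... | tri> _ _ x<0 | tri> _ _ y<0 = pos⇒≉0 (neg-* x<0 y<0)

  pos-cancelˡ : ∀ {x y} → 0# < x → 0# < x * y → 0# < y
  pos-cancelˡ {x} {y} 0<x 0<xy with compare 0# y
  ... | tri< 0<y _ _ = 0<y
  ... | tri≈ _ 0≈y _ = contradiction 0<xy (irrefl (trans (sym (zeroʳ x)) (*-congˡ 0≈y)))
  ... | tri> _ _ y<0 = contradiction 0<xy (asym (pos-*-neg 0<x y<0))

  neg-cancelˡ : ∀ {x y} → 0# < x → x * y < 0# → y < 0#
  neg-cancelˡ {x} {y} 0<x xy<0 = 0<-⇒<0 (pos-cancelˡ 0<x
    (<-respʳ-≈ (solve 2 (λ x y → :- (x :* y) := x :* :- y) refl x y) (<0⇒0<- xy<0)))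

  divide : ∀ x {y} → 0# < y → ∃[ q ] q * y ≈ x
  divide x {y} 0<y with y⁻¹ , y⁻¹y≈1 , _ ← invertible y (pos⇒≉0 0<y) =
    x * y⁻¹ , trans (*-assoc _ _ _) (trans (*-congˡ y⁻¹y≈1) (*-identityʳ x))

  divide-pos : ∀ {x y} → 0# < x → 0# < y → ∃[ q ] 0# < q × q * y ≈ x
  divide-pos {x} {y} 0<x 0<y with q , qy≈x ← divide x 0<y =
    q , pos-cancelˡ 0<y (<-respʳ-≈ (trans (sym qy≈x) (*-comm q y)) 0<x) , qy≈x

  halve : ∀ {x} → 0# < x → ∃[ h ] 0# < h × h + h ≈ x
  halve 0<x with h , 0<h , h*2≈x ← divide-pos 0<x (+-pos 0<1 0<1) =
    h , 0<h , trans (+-cong (sym (*-identityʳ h)) (sym (*-identityʳ h)))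
                (trans (sym (distribˡ h 1# 1#)) h*2≈x)

  -- Small multiples and minima of finite families

  infix 4 ∣_∣<_

  ∣_∣<_ : Carrier → Carrier → Set
  ∣ z ∣< η = (z < η) × (- z < η)

  ∣-∣< : ∀ {z η} → ∣ z ∣< η → ∣ - z ∣< η
  ∣-∣< {z} (z<η , -z<η) = -z<η , <-respˡ-≈ (solve 1 (λ z → z := :- :- z) refl z) z<η

  -- For `e` nonzero, `η` is `ε` divided by the absolute value of `e`. Only the upper bound is
  -- recorded; the lower one comes from applying it to `- z`.
  *-small : ∀ {ε} e → 0# < ε → ∃[ η ] 0# < η × ∀ z → ∣ z ∣< η → z * e < ε
  *-small {ε} e 0<ε with compare 0# e
  ... | tri≈ _ 0≈e _ = 1# , 0<1 , λ z _ →
    <-respˡ-≈ (trans (sym (zeroʳ z)) (*-congˡ 0≈e)) 0<ε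
  ... | tri< 0<e _ _ with η , 0<η , ηe≈ε ← divide-pos 0<ε 0<e = η , 0<η , λ z (z<η , _) →
    0<∸⇒< (<-respʳ-≈ (trans (solve 3 (λ z e η → (η :- z) :* e := η :* e :- z :* e) refl z e η)
        (+-congʳ ηe≈ε))
      (*-pos (<⇒0<∸ z<η) 0<e))
  ... | tri> _ _ e<0 with η , 0<η , ηe≈ε ← divide-pos 0<ε (<0⇒0<- e<0) = η , 0<η , λ z (_ , -z<η) →
    0<∸⇒< (<-respʳ-≈ (trans
        (solve 3 (λ z e η → (η :- :- z) :* :- e := η :* :- e :- z :* e) refl z e η) (+-congʳ ηe≈ε))
      (*-pos (<⇒0<∸ -z<η) (<0⇒0<- e<0)))

  lower-bound₂ : ∀ {a b} → 0# < a → 0# < b → ∃[ μ ] 0# < μ × ∀ t → t < μ → t < a × t < b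
  lower-bound₂ {a} {b} 0<a 0<b with compare a b
  ... | tri< a<b _ _ = a , 0<a , λ t t<a → t<a , <-trans t<a a<b
  ... | tri≈ _ a≈b _ = a , 0<a , λ t t<a → t<a , <-respʳ-≈ a≈b t<a
  ... | tri> _ _ b<a = b , 0<b , λ t t<b → <-trans t<b b<a , t<b

  lower-bound : ∀ {m} (a : Vector Carrier m) → (∀ i → 0# < a i) →
                ∃[ μ ] 0# < μ × ∀ t → t < μ → ∀ i → t < a i
  lower-bound {zero} a 0<a = 1# , 0<1 , λ _ _ ()
  lower-bound {suc m} a 0<a
    with μ , 0<μ , below ← lower-bound (a ∘ suc) (0<a ∘ suc)
    with ν , 0<ν , below₂ ← lower-bound₂ (0<a zero) 0<μ
    = ν , 0<ν , λ where
      t t<ν zero    → proj₁ (below₂ t t<ν)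
      t t<ν (suc i) → below t (proj₂ (below₂ t t<ν)) i

  *-small-family : ∀ {m} {ε : Vector Carrier m} (e : Vector Carrier m) → (∀ i → 0# < ε i) →
                   ∃[ η ] 0# < η × ∀ z → ∣ z ∣< η → ∀ i → z * e i < ε i
  *-small-family e 0<ε =
    let bound = λ i → *-small (e i) (0<ε i)
        μ , 0<μ , below = lower-bound (proj₁ ∘ bound) (proj₁ ∘ proj₂ ∘ bound)
    in μ , 0<μ , λ z (z<μ , -z<μ) i → proj₂ (proj₂ (bound i)) z (below z z<μ i , below (- z) -z<μ i)

  halfway : ∀ {x} → 0# < x → ∃[ h ] 0# < h × h < x
  halfway 0<x with h , 0<h , h+h≈x ← halve 0<x =
    h , 0<h , <-respˡ-≈ (+-identityˡ h) (<-respʳ-≈ h+h≈x (+-monoˡ-< h 0<h))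

  pos⇒∣∣< : ∀ {t η} → 0# < t → t < η → ∣ t ∣< η
  pos⇒∣∣< {t} 0<t t<η = t<η ,
    <-trans (0<-⇒<0 (<-respʳ-≈ (solve 1 (λ z → z := :- :- z) refl t) 0<t)) (<-trans 0<t t<η)

  sum-nonneg : ∀ {m} (t : Vector Carrier m) → (∀ i → 0# ≤ t i) → 0# ≤ sum t
  sum-nonneg {zero} t 0≤t = inj₂ refl
  sum-nonneg {suc m} t 0≤t = +-nonneg (0≤t zero) (sum-nonneg (t ∘ suc) (0≤t ∘ suc))

  sum-pos : ∀ {m} (t : Vector Carrier m) → (∀ i → 0# ≤ t i) → ∀ k → 0# < t k → 0# < sum t
  sum-pos t 0≤t zero 0<tk = +-pos-nonneg 0<tk (sum-nonneg (t ∘ suc) (0≤t ∘ suc))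
  sum-pos t 0≤t (suc k) 0<tk = +-nonneg-pos (0≤t zero) (sum-pos (t ∘ suc) (0≤t ∘ suc) k 0<tk)

  -- Otherwise all terms are nonnegative, and the nonzero one makes the sum positive.
  sum≈0⇒neg : ∀ {m} (t : Vector Carrier m) → sum t ≈ 0# → ∀ k → t k ≉ 0# → ∃[ i ] t i < 0#
  sum≈0⇒neg t ∑t≈0 k tk≉0 with any? (λ i → t i <? 0#)
  ... | yes neg = neg
  ... | no ∄neg = contradiction (sum-pos t nonneg k (≥0∧≉0⇒pos (nonneg k) tk≉0)) (irrefl (sym ∑t≈0))
    where nonneg = λ i → ≮⇒≥ (λ ti<0 → ∄neg (i , ti<0))

  sum≈0⇒pos : ∀ {m} (t : Vector Carrier m) → sum t ≈ 0# → ∀ k → t k ≉ 0# → ∃[ i ] 0# < t i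
  sum≈0⇒pos t ∑t≈0 k tk≉0 =
    let i , p = sum≈0⇒neg (λ i → - 1# * t i)
                  (trans (sym (*-distribˡ-sum (- 1#) t)) (trans (*-congˡ ∑t≈0) (zeroʳ _))) k
                  (*-≉0 (neg⇒≉0 (0<-⇒<0 (<-respʳ-≈ (sym (-‿involutive 1#)) 0<1))) tk≉0)
    in i , <-respʳ-≈ (trans (-‿cong (-1*x≈-x (t i))) (-‿involutive (t i))) (<0⇒0<- p)
    where open import Algebra.Properties.Ring ring using (-‿involutive; -1*x≈-x)

  argmin : ∀ {m} {P : Pred (Fin m) 0ℓ} → Decidable P → (q : Vector Carrier m) → Satisfiable P →
           ∃[ k ] P k × ∀ i → P i → q k ≤ q i
  argmin {suc m} {P} P? q (k₀ , pk₀) with any? (P? ∘ suc)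
  argmin {suc m} {P} P? q (suc k₀ , pk₀) | no ∄ = contradiction (k₀ , pk₀) ∄
  argmin {suc m} {P} P? q (zero , p0) | no ∄ = zero , p0 , λ where
    zero _ → inj₂ refl
    (suc i) p → contradiction (i , p) ∄
  ... | yes ∃P with k , pk , min ← argmin (P? ∘ suc) (q ∘ suc) ∃P with P? zero | q zero <? q (suc k)
  ...   | no ¬p0 | _ = suc k , pk , λ where
    zero p → contradiction p ¬p0
    (suc i) p → min i p
  ...   | yes p0 | yes q0<qk = zero , p0 , λ where
    zero _ → inj₂ refl
    (suc i) p → inj₁ (<-≤-trans q0<qk (min i p))
  ...   | yes p0 | no q0≮qk = suc k , pk , λ where
    zero _ → ≮⇒≥ q0≮qk
    (suc i) p → min i p

-- Gordan's theorem and circuits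

decidableSubset : ∀ {m} {P : Pred (Fin m) 0ℓ} → Decidable P → Subset m
decidableSubset P? = tabulate (does ∘ P?)

∈-decidableSubset : ∀ {m} {P : Pred (Fin m) 0ℓ} (P? : Decidable P) i → i ∈ₛ decidableSubset P? ⇔ P i
∈-decidableSubset P? i = mk⇔
  (λ i∈ → witness (P? i) (≡.trans (≡.sym (lookup∘tabulate (does ∘ P?) i)) ([]=⇒lookup i∈)))
  (λ p → lookup⇒[]= i _ (≡.trans (lookup∘tabulate (does ∘ P?) i) (dec-true (P? i) p)))
  where
  witness : ∀ {A : Set} (a? : Dec A) → does a? ≡ true → A
  witness (yes a) _ = a
  witness (no _) ()

module Duality (ℝ : CompleteOrderedField) where

  open CompleteOrderedField ℝ hiding (zero; setoid)
  open OverReals ℝ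
  open OrderedField ℝ
  open IntegerCoefficients commutativeRing
  open SemiringSum semiring using (sum; *-distribˡ-sum; sum-cong-≋; ∑-distrib-+; ∑-comm)

  open import Relation.Binary.Reasoning.Setoid (CompleteOrderedField.setoid ℝ)

  -- Bilinearity of the dot product

  ·-comm : ∀ {n} (x y : ℝ^ n) → x · y ≈ y · x
  ·-comm x y = sum-cong-≋ (λ j → *-comm (x j) (y j))

  ·-scaleˡ : ∀ {n} t (x e : ℝ^ n) → (λ j → t * x j) · e ≈ t * (x · e)
  ·-scaleˡ t x e = trans (sum-cong-≋ (λ j → *-assoc t (x j) (e j)))
      (sym (*-distribˡ-sum t (λ j → x j * e j)))

  ·-linearˡ : ∀ {n} (x : ℝ^ n) t y e → (λ j → x j + t * y j) · e ≈ x · e + t * (y · e)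
  ·-linearˡ x t y e = trans (sum-cong-≋ (λ j → distribʳ (e j) (x j) (t * y j)))
    (trans (∑-distrib-+ (λ j → x j * e j) (λ j → t * y j * e j)) (+-congˡ (·-scaleˡ t y e)))

  ·-scaleʳ : ∀ {n} t (x e : ℝ^ n) → x · (λ j → t * e j) ≈ t * (x · e)
  ·-scaleʳ t x e = trans (·-comm x _) (trans (·-scaleˡ t e x) (*-congˡ (·-comm e x)))

  ·-linearʳ : ∀ {n} (x e : ℝ^ n) t f → x · (λ j → e j + t * f j) ≈ x · e + t * (x · f)
  ·-linearʳ x e t f = trans (·-comm x _)
    (trans (·-linearˡ e t f x) (+-cong (·-comm e x) (*-congˡ (·-comm f x))))

  ·-congˡ : ∀ {n} {x y : ℝ^ n} e → (∀ j → x j ≈ y j) → x · e ≈ y · e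
  ·-congˡ e x≈y = sum-cong-≋ (λ j → *-congʳ (x≈y j))

  ·-zeroˡ : ∀ {n} {x : ℝ^ n} e → (∀ j → x j ≈ 0#) → x · e ≈ 0#
  ·-zeroˡ e x≈0 = trans (·-congˡ {y = λ j → 0# * e j} e (λ j → trans (x≈0 j) (sym (zeroˡ (e j)))))
    (trans (·-scaleˡ 0# e e) (zeroˡ (e · e)))

  ·-zeroʳ : ∀ {n} x {e : ℝ^ n} → (∀ j → e j ≈ 0#) → x · e ≈ 0#
  ·-zeroʳ x {e} e≈0 = trans (·-comm x e) (·-zeroˡ x e≈0)

  square≥0 : ∀ x → 0# ≤ x * x
  square≥0 x with compare 0# x
  ... | tri< 0<x _ _ = inj₁ (*-pos 0<x 0<x)
  ... | tri≈ _ 0≈x _ = inj₂ (trans (sym (zeroˡ x)) (*-congʳ 0≈x))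
  ... | tri> _ _ x<0 = inj₁ (neg-* x<0 x<0)

  ·-self-pos : ∀ {n} (x : ℝ^ n) j → x j ≉ 0# → 0# < x · x
  ·-self-pos x j xj≉0 =
      sum-pos _ (λ i → square≥0 (x i)) j (≥0∧≉0⇒pos (square≥0 (x j)) (*-≉0 xj≉0 xj≉0))

  -- Interchanging the two summations turns the left side into the product of `x` with the vector
  -- `∑ cᵢ Eᵢ`, which is zero.
  dependency-· : ∀ {n m} (E : Fin m → ℝ^ n) {c} → LinearDependency E c → ∀ x →
      c · (λ i → x · E i) ≈ 0#
  dependency-· E {c} dep x = begin
    sum (λ i → c i * sum (λ j → x j * E i j))
      ≈⟨ sum-cong-≋ (λ i → *-distribˡ-sum (c i) (λ j → x j * E i j)) ⟩
    sum (λ i → sum (λ j → c i * (x j * E i j)))  ≈⟨ ∑-comm (λ i j → c i * (x j * E i j)) ⟩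
    sum (λ j → sum (λ i → c i * (x j * E i j)))
      ≈⟨ sum-cong-≋ (λ j → ·-scaleʳ (x j) c (λ i → E i j)) ⟩
    sum (λ j → x j * sum (λ i → c i * E i j))    ≈⟨ ·-zeroʳ x dep ⟩
    0#                                           ∎

  -- Semipositive dependencies and Gordan's theorem

  Positive : ∀ {n m} → (Fin m → ℝ^ n) → Pred (ℝ^ n) 0ℓ
  Positive v x = ∀ i → 0# < x · v i

  Conforms : ∀ {m} → Vector Carrier m → Pred (Vector Carrier m) 0ℓ
  Conforms s c = ∀ i → 0# ≤ s i * c i

  record SemipositiveDependency {n m} (v : Fin m → ℝ^ n) : Set where
    constructor semipositive
    field
      coefficients : Vector Carrier m
      dependency   : LinearDependency v coefficients
      nonneg       : ∀ i → 0# ≤ coefficients i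
      nonempty     : Satisfiable (Support v coefficients)

  -- Any positive step from `z` along `u` makes the product with `v zero` positive, and a short
  -- enough one preserves the finitely many strict inequalities that already hold.
  perturb : ∀ {n m} (v : Fin (suc m) → ℝ^ n) z u → Positive (v ∘ suc) z → z · v zero ≈ 0# →
            0# < u · v zero → Satisfiable (Positive v)
  perturb v z u pos zero≈0 0<u with η , 0<η , small ← *-small-family (λ i → u · v (suc i)) pos
    with t , 0<t , t<η ← halfway 0<η = (λ j → z j + t * u j) , λ where
      zero → <-respʳ-≈
        (sym (trans (·-linearˡ z t u (v zero)) (trans (+-congʳ zero≈0) (+-identityˡ _))))
        (*-pos 0<t 0<u)
      (suc i) → <-respʳ-≈
        (trans (solve 3 (λ a t b → a :- :- t :* b := a :+ t :* b) refl
            (z · v (suc i)) t (u · v (suc i)))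
          (sym (·-linearˡ z t u (v (suc i)))))
        -- The bound from above on the multiples of `- t` is the bound from below needed for those
        -- of `t`.
        (<⇒0<∸ (small (- t) (∣-∣< (pos⇒∣∣< 0<t t<η)) i))

  cons-zero : ∀ {n m} (v : Fin (suc m) → ℝ^ n) → SemipositiveDependency (v ∘ suc) →
      SemipositiveDependency v
  cons-zero v (semipositive c dep 0≤c (k , ck≉0)) = semipositive (0# ∷ c)
    (λ j → trans (+-cong (zeroˡ (v zero j)) (dep j)) (+-identityˡ 0#))
    (λ { zero → inj₂ refl ; (suc i) → 0≤c i })
    (suc k , ck≉0)

  zero-dependency : ∀ {n m} (v : Fin (suc m) → ℝ^ n) → (∀ j → v zero j ≈ 0#) →
      SemipositiveDependency v
  zero-dependency v v₀≈0 = semipositive (1# ∷ λ _ → 0#)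
    (λ j → trans (+-cong (trans (*-congˡ (v₀≈0 j)) (zeroʳ 1#))
        (·-zeroˡ (λ i → v (suc i) j) (λ _ → refl))) (+-identityˡ 0#))
    (λ { zero → inj₁ 0<1 ; (suc i) → inj₂ refl })
    (zero , 0≉1 ∘ sym)

  module _ {n m} (v : Fin (suc m) → ℝ^ n) (p : Vector Carrier m) where

    -- The weights stay arbitrary: lifting a dependency asks for `p i` positive, lifting a solution
    -- asks for projections orthogonal to some `x`. The choice in `gordan` meets both demands.
    project : Fin m → ℝ^ n
    project i j = v (suc i) j + p i * v zero j

    -- Expanding the projections collects `∑ cᵢ pᵢ` copies of `v zero`, and this coefficient is
    -- nonnegative.
    lift-dependency : (∀ i → 0# < p i) → SemipositiveDependency project → SemipositiveDependency v
    lift-dependency 0<p (semipositive c dep 0≤c (k , ck≉0)) = semipositive ((c · p) ∷ c)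
      (λ j → trans (lift-sum j) (dep j))
      (λ { zero → sum-nonneg _ (λ i → *-nonneg (0≤c i) (inj₁ (0<p i))) ; (suc i) → 0≤c i })
      (suc k , ck≉0)
      where
      lift-sum : ∀ j → c · p * v zero j + c · (λ i → v (suc i) j) ≈ c · λ i → project i j
      lift-sum j = begin
        c · p * v zero j + c · (λ i → v (suc i) j)    ≈⟨ +-comm _ _ ⟩
        c · (λ i → v (suc i) j) + c · p * v zero j    ≈⟨ +-congˡ (*-comm _ _) ⟩
        c · (λ i → v (suc i) j) + v zero j * (c · p)
          ≈⟨ ·-linearʳ c (λ i → v (suc i) j) (v zero j) p ⟨
        c · (λ i → v (suc i) j + v zero j * p i)
          ≈⟨ sum-cong-≋ (λ i → *-congˡ (+-congˡ (*-comm (v zero j) (p i)))) ⟩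
        c · (λ i → project i j)                       ∎

    -- Adding multiples of `x` to `y` does not change its products with the projections, so `t` is
    -- free to be chosen such that `z` is orthogonal to `v zero`. Then `v (suc i)` and its
    -- projection have the same, positive product with `z`, and a small step along the negative of
    -- `x` repairs `v zero`.
    lift-solution : ∀ x → (∀ i → x · project i ≈ 0#) → x · v zero < 0# →
                    Satisfiable (Positive project) → Satisfiable (Positive v)
    lift-solution x x⊥w xv₀<0 (y , pos) = perturb v z (λ j → - 1# * x j) posz zv₀≈0
        (<-respʳ-≈ (sym (trans (·-scaleˡ (- 1#) x (v zero)) (-1*x≈-x _))) (<0⇒0<- xv₀<0))
      where
      open import Algebra.Properties.Ring ring using (-1*x≈-x)
      t = divide (y · v zero) (<0⇒0<- xv₀<0)
      z : ℝ^ n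
      z j = y j + proj₁ t * x j
      zv₀≈0 : z · v zero ≈ 0#
      zv₀≈0 = begin
        z · v zero
          ≈⟨ ·-linearˡ y (proj₁ t) x (v zero) ⟩
        y · v zero + proj₁ t * (x · v zero)                        ≈⟨ +-congʳ (proj₂ t) ⟨
        proj₁ t * - (x · v zero) + proj₁ t * (x · v zero)
          ≈⟨ solve 2 (λ t b → t :* :- b :+ t :* b := con 0ℤ) refl (proj₁ t) (x · v zero) ⟩
        0#                                                         ∎
      posz : ∀ i → 0# < z · v (suc i)
      posz i = <-respʳ-≈ (begin
        y · project i                                 ≈⟨ +-identityʳ _ ⟨
        y · project i + 0#
          ≈⟨ +-congˡ (trans (*-congˡ (x⊥w i)) (zeroʳ _)) ⟨
        y · project i + proj₁ t * (x · project i)     ≈⟨ ·-linearˡ y (proj₁ t) x (project i) ⟨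
        z · project i                                 ≈⟨ ·-linearʳ z (v (suc i)) (p i) (v zero) ⟩
        z · v (suc i) + p i * (z · v zero)            ≈⟨ +-congˡ (trans (*-congˡ zv₀≈0) (zeroʳ _)) ⟩
        z · v (suc i) + 0#                            ≈⟨ +-identityʳ _ ⟩
        z · v (suc i)                                 ∎) (pos i)

  -- Induction on m: if a solution x for the other vectors fails at v₀, replace each of them by
  -- its projection along v₀ into the hyperplane orthogonal to x.
  gordan : ∀ {n m} (v : Fin m → ℝ^ n) → Satisfiable (Positive v) ⊎ SemipositiveDependency v
  gordan {m = zero} v = inj₁ ((λ _ → 0#) , λ ())
  gordan {n} {suc m} v with gordan (v ∘ suc)
  ... | inj₂ dep = inj₂ (cons-zero v dep)
  ... | inj₁ (x , pos) with compare 0# (x · v zero)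
  ...   | tri< 0<xv₀ _ _ = inj₁ (x , λ { zero → 0<xv₀ ; (suc i) → pos i })
  -- On the boundary, a small step along `v zero` itself suffices, unless this vector is zero and so
  -- a dependency on its own.
  ...   | tri≈ _ 0≈xv₀ _ with any? (λ j → ¬? (v zero j ≟ 0#))
  ...     | yes (j , v₀j≉0) =
      inj₁ (perturb v x (v zero) pos (sym 0≈xv₀) (·-self-pos (v zero) j v₀j≉0))
  ...     | no ∄ = inj₂
      (zero-dependency v (λ j → decidable-stable (v zero j ≟ 0#) (λ v₀j≉0 → ∄ (j , v₀j≉0))))
  gordan {n} {suc m} v | inj₁ (x , pos) | tri> _ _ xv₀<0 =
      Sum.map (lift-solution v p x x⊥w xv₀<0)
          (lift-dependency v p (λ i → proj₁ (proj₂ (factor i)))) (gordan (project v p))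
    where
    -- The ratio is positive because `x` is positive on `v (suc i)` and negative on `v zero`; it is
    -- the weight at which the two contributions cancel.
    factor : ∀ i → ∃[ q ] 0# < q × q * - (x · v zero) ≈ x · v (suc i)
    factor i = divide-pos (pos i) (<0⇒0<- xv₀<0)
    p : Vector Carrier m
    p i = proj₁ (factor i)
    x⊥w : ∀ i → x · project v p i ≈ 0#
    x⊥w i = begin
      x · project v p i
        ≈⟨ ·-linearʳ x (v (suc i)) (p i) (v zero) ⟩
      x · v (suc i) + p i * (x · v zero)                  ≈⟨ +-congʳ (proj₂ (proj₂ (factor i))) ⟨
      p i * - (x · v zero) + p i * (x · v zero)
        ≈⟨ solve 2 (λ t b → t :* :- b :+ t :* b := con 0ℤ) refl (p i) (x · v zero) ⟩
      0#                                                  ∎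

  -- Conformal dependencies of minimal support

  record ConformalDependency {n m} (E : Fin m → ℝ^ n) (s c : Vector Carrier m) : Set where
    field
      dependency : LinearDependency E c
      conforms   : Conforms s c
      nonempty   : Satisfiable (Support E c)

  reorient : ∀ {n m} → Vector Carrier m → (Fin m → ℝ^ n) → Fin m → ℝ^ n
  reorient s E i j = s i * E i j

  -- The signs move into the coefficients: `cᵢ (sᵢ Eᵢ) = (cᵢ sᵢ) Eᵢ`, and `sᵢ (cᵢ sᵢ)` is `cᵢ` times
  -- a square.
  gordan-conformal : ∀ {n m} (E : Fin m → ℝ^ n) {s} → (∀ i → s i ≉ 0#) →
                     Satisfiable (Positive (reorient s E)) ⊎ Satisfiable (ConformalDependency E s)
  gordan-conformal E {s} s≉0 =
      Sum.map₂ (λ (semipositive c dep 0≤c (k , ck≉0)) → (λ i → c i * s i) , record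
      { dependency = λ j → trans (sum-cong-≋ (λ i → *-assoc (c i) (s i) (E i j))) (dep j)
      ; conforms = λ i → ≤-resp (solve 2 (λ c s → c :* (s :* s) := s :* (c :* s)) refl (c i) (s i))
          (*-nonneg (0≤c i) (square≥0 (s i)))
      ; nonempty = k , *-≉0 ck≉0 (s≉0 k)
      }) (gordan (reorient s E))

  support : ∀ {m} → Vector Carrier m → Subset m
  support c = decidableSubset (λ i → ¬? (c i ≟ 0#))

  ∈-support : ∀ {m} (c : Vector Carrier m) i → i ∈ₛ support c ⇔ c i ≉ 0#
  ∈-support c = ∈-decidableSubset (λ i → ¬? (c i ≟ 0#))

  -- The ratio C k / D k is minimal among those with positive denominator; cross-multiplied.
  critical : ∀ {m} (C D : Vector Carrier m) → ∃[ k ] 0# < D k →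
             ∃[ k ] 0# < D k × ∀ i → 0# < D i → 0# ≤ D k * C i - C k * D i
  critical C D ∃pos = compareWith (argmin (λ i → 0# <? D i) (proj₁ ∘ ratio) ∃pos)
    where
    ratio : ∀ i → ∃[ q ] (0# < D i → q * D i ≈ C i)
    ratio i with 0# <? D i
    ... | yes 0<D = proj₁ (divide (C i) 0<D) , λ _ → proj₂ (divide (C i) 0<D)
    -- The filler `0#` never affects the minimum, which is taken over positive denominators.
    ... | no 0≮D = 0# , λ 0<D → contradiction 0<D 0≮D
    compareWith : ∃[ k ] 0# < D k × (∀ i → 0# < D i → proj₁ (ratio k) ≤ proj₁ (ratio i)) →
                  ∃[ k ] 0# < D k × ∀ i → 0# < D i → 0# ≤ D k * C i - C k * D i
    compareWith (k , 0<Dk , min) = k , 0<Dk , λ i 0<Di →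
      let qk , qkDk≈Ck = ratio k
          qi , qiDi≈Ci = ratio i
      in ≤-resp (begin
        D k * D i * (qi - qk)
          ≈⟨ solve 4 (λ a b x y → a :* b :* (x :- y) := a :* (x :* b) :- y :* a :* b) refl
              (D k) (D i) qi qk ⟩
        D k * (qi * D i) - qk * D k * D i
          ≈⟨ +-cong (*-congˡ (qiDi≈Ci 0<Di)) (-‿cong (*-congʳ (qkDk≈Ck 0<Dk))) ⟩
        D k * C i - C k * D i                  ∎)
        (*-nonneg (inj₁ (*-pos 0<Dk 0<Di)) (≤⇒0≤∸ (min i 0<Di)))

  -- Move from c in the direction of -d until the first coordinate vanishes.  Everything is
  -- scaled by sₖdₖ, where k is the coordinate that vanishes.
  shrink : ∀ {n m} (E : Fin m → ℝ^ n) {s c d} → ConformalDependency E s c → LinearDependency E d →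
           Support E d ⊆ Support E c → ∃[ k ] 0# < s k * d k → ∀ {i} → d i ≈ 0# → c i ≉ 0# →
           ∃[ c′ ] ConformalDependency E s c′ × support c′ ⊂ support c
  shrink {m = m} E {s} {c} {d} conf ddep d⊆c ∃pos {i₀} di₀≈0 ci₀≉0 = shrinkAt (critical C D ∃pos)
    where
    open ConformalDependency conf
    C = λ i → s i * c i
    D = λ i → s i * d i
    shrinkAt : ∃[ k ] 0# < D k × (∀ i → 0# < D i → 0# ≤ D k * C i - C k * D i) →
               ∃[ c′ ] ConformalDependency E s c′ × support c′ ⊂ support c
    shrinkAt (k , 0<Dk , min) = c′ , record
        { dependency = λ j → let e = λ i → E i j in begin
            c′ · e
              ≈⟨ ·-linearˡ (λ i → D k * c i) (- C k) d e ⟩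
            (λ i → D k * c i) · e + - C k * (d · e)
              ≈⟨ +-cong (trans (·-scaleˡ (D k) c e) (*-congˡ (dependency j))) (*-congˡ (ddep j)) ⟩
            D k * 0# + - C k * 0#
              ≈⟨ solve 2 (λ a b → a :* con 0ℤ :+ :- b :* con 0ℤ := con 0ℤ) refl (D k) (C k) ⟩
            0#                                           ∎
        ; conforms = λ i → ≤-resp (sc′≈ i) (nonneg i)
        -- At `i₀` only `d` vanishes, so a nonzero multiple of `c i₀` survives the move.
        ; nonempty = i₀ , λ c′≈0 → *-≉0 (pos⇒≉0 0<Dk) ci₀≉0 (begin
            D k * c i₀                        ≈⟨ +-identityʳ _ ⟨
            D k * c i₀ + 0#                   ≈⟨ +-congˡ (trans (*-congˡ di₀≈0) (zeroʳ _)) ⟨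
            D k * c i₀ + - C k * d i₀         ≈⟨ c′≈0 ⟩
            0#                                ∎)
        } , (λ {i} i∈ → from (∈-support c i) (λ ci≈0 → to (∈-support c′ i) i∈ (c′-zero ci≈0)))
        , k , from (∈-support c k) (d⊆c λ dk≈0 → pos⇒≉0 0<Dk (trans (*-congˡ dk≈0) (zeroʳ _)))
        , λ k∈ → to (∈-support c′ k) k∈
            (solve 3 (λ s c d → s :* d :* c :+ :- (s :* c) :* d := con 0ℤ) refl (s k) (c k) (d k))
      where
      open Equivalence
      c′ : Vector Carrier m
      c′ i = D k * c i + - C k * d i
      sc′≈ : ∀ i → D k * C i - C k * D i ≈ s i * c′ i
      sc′≈ i = solve 5
        (λ a b s c d → a :* (s :* c) :- b :* (s :* d) := s :* (a :* c :+ :- b :* d)) refl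
        (D k) (C k) (s i) (c i) (d i)
      nonneg : ∀ i → 0# ≤ D k * C i - C k * D i
      nonneg i with 0# <? D i
      ... | yes 0<Di = min i 0<Di
      -- Where `D i` is not positive, subtracting a nonnegative multiple of it cannot lower the
      -- coordinate.
      ... | no 0≮Di = ≤-resp
        (solve 4 (λ a b x y → a :* b :+ x :* (con 0ℤ :- y) := a :* b :- x :* y) refl
          (D k) (C i) (C k) (D i))
        (+-nonneg (*-nonneg (inj₁ 0<Dk) (conforms i)) (*-nonneg (conforms k) (≤⇒0≤∸ (≮⇒≥ 0≮Di))))
      c′-zero : ∀ {i} → c i ≈ 0# → c′ i ≈ 0#
      c′-zero {i} ci≈0 = begin
        D k * c i + - C k * d i
          ≈⟨ +-cong (*-congˡ ci≈0) (*-congˡ (decidable-stable (d i ≟ 0#) λ di≉0 → d⊆c di≉0 ci≈0)) ⟩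
        D k * 0# + - C k * 0#
          ≈⟨ solve 2 (λ a b → a :* con 0ℤ :+ :- b :* con 0ℤ := con 0ℤ) refl (D k) (C k) ⟩
        0#                           ∎

  -- The descent stops at a dependency minimal among the conformal ones. If some `d` had strictly
  -- smaller support, `shrink` would produce a smaller conformal dependency, so minimality holds
  -- among all dependencies.
  minimal-conformal : ExcludedMiddle 0ℓ → ∀ {n m} (E : Fin m → ℝ^ n) {s} → (∀ i → s i ≉ 0#) → ∀ c →
                      ConformalDependency E s c → ∃[ c′ ] IsMinimalDependency E c′ × Conforms s c′
  minimal-conformal em {m = m} E {s} s≉0 c₀ conf₀ = go c₀ (⊂-wellFounded (support c₀)) conf₀
    where
    go : ∀ c → Acc _⊂_ (support c) → ConformalDependency E s c →
        ∃[ c′ ] IsMinimalDependency E c′ × Conforms s c′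
    go c (acc rec) conf with em {∃[ c′ ] ConformalDependency E s c′ × support c′ ⊂ support c}
    ... | yes (c′ , conf′ , c′⊂c) = go c′ (rec c′⊂c) conf′
    ... | no ∄smaller =
        c , record { dependency = dependency ; nonempty = nonempty ; minimal = minimal } , conforms
      where
      open ConformalDependency conf
      minimal : ∀ d → LinearDependency E d → Satisfiable (Support E d) →
          Support E d ⊆ Support E c → Support E c ⊆ Support E d
      minimal d ddep (k , dk≉0) d⊆c ci≉0 di≈0 with compare 0# (s k * d k)
      ... | tri< 0<sd _ _ = ∄smaller (shrink E conf ddep d⊆c (k , 0<sd) di≈0 ci≉0)
      ... | tri≈ _ 0≈sd _ = *-≉0 (s≉0 k) dk≉0 (sym 0≈sd)
      -- `shrink` asks for a coordinate at which the direction agrees in sign with `s`; here the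
      -- negative of `d` has one.
      ... | tri> _ _ sd<0 = ∄smaller (shrink E {d = λ i → - 1# * d i} conf
        (λ j → trans (·-scaleˡ (- 1#) d (λ i → E i j)) (trans (*-congˡ (ddep j)) (zeroʳ _)))
        (λ -di≉0 → d⊆c λ di≈0 → -di≉0 (trans (*-congˡ di≈0) (zeroʳ _)))
        (k , <-respʳ-≈ (solve 2 (λ s d → :- (s :* d) := s :* (con -1ℤ :* d)) refl (s k) (d k))
            (<0⇒0<- sd<0))
        (trans (*-congˡ di≈0) (zeroʳ _)) ci≉0)

  gordan-circuit : ExcludedMiddle 0ℓ → ∀ {n m} (E : Fin m → ℝ^ n) {s} → (∀ i → s i ≉ 0#) →
                   Satisfiable (Positive (reorient s E)) ⊎
                   ∃[ c ] IsMinimalDependency E c × Conforms s c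
  gordan-circuit em E s≉0 =
      Sum.map₂ (λ (c , conf) → minimal-conformal em E s≉0 c conf) (gordan-conformal E s≉0)

-- Colorings

module Colorings (ℝ : CompleteOrderedField) where

  open CompleteOrderedField ℝ hiding (zero; setoid)
  open OverReals ℝ
  open OrderedField ℝ
  open Duality ℝ
  open IntegerCoefficients commutativeRing
  open Equivalence

  sgn : Fin 2 → Carrier
  sgn 0F = 1#
  sgn 1F = - 1#

  sgn-square : ∀ κ x → sgn κ * (sgn κ * x) ≈ x
  sgn-square 0F x = trans (*-identityˡ _) (*-identityˡ x)
  sgn-square 1F = solve 1 (λ x → :- con 1ℤ :* (:- con 1ℤ :* x) := x) refl

  sgn≉0 : ∀ κ → sgn κ ≉ 0#
  sgn≉0 κ sgn≈0 = 0≉1 (trans (sym (zeroˡ _)) (trans (*-congʳ (sym sgn≈0)) (sgn-square κ 1#)))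

  -1*<0 : ∀ {x} → 0# < - 1# * x → x < 0#
  -1*<0 {x} p = 0<-⇒<0 (<-respʳ-≈ (solve 1 (λ x → :- con 1ℤ :* x := :- x) refl x) p)

  0<-1* : ∀ {x} → x < 0# → 0# < - 1# * x
  0<-1* {x} p = <-respʳ-≈ (solve 1 (λ x → :- x := :- con 1ℤ :* x) refl x) (<0⇒0<- p)

  <0-1* : ∀ {x} → - 1# * x < 0# → 0# < x
  <0-1* {x} p = <-respʳ-≈ (solve 1 (λ x → :- (:- con 1ℤ :* x) := x) refl x) (<0⇒0<- p)

  1*-pos : ∀ {x} → 0# < 1# * x → 0# < x
  1*-pos = <-respʳ-≈ (*-identityˡ _)

  1*-neg : ∀ {x} → 1# * x < 0# → x < 0#
  1*-neg = <-respˡ-≈ (*-identityˡ _)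

  module _ {n m} (E : Fin m → ℝ^ n) where

    -- Phrased as the solution set of a reoriented system, so that `gordan-circuit` and
    -- `positive-convex` apply directly; `cell-pos` recovers the form with explicit signs.
    Cell : (Fin m → Fin 2) → Pred (ℝ^ n) 0ℓ
    Cell ε = Positive (reorient (sgn ∘ ε) E)

    cell-pos : ∀ ε {x} → Cell ε x → ∀ i → 0# < sgn (ε i) * (x · E i)
    cell-pos ε {x} cell i = <-respʳ-≈ (·-scaleʳ (sgn (ε i)) x (E i)) (cell i)

    cell-≉0 : ∀ ε {x} → Cell ε x → ∀ i → x · E i ≉ 0#
    cell-≉0 ε cell i xE≈0 = pos⇒≉0 (cell-pos ε cell i) (trans (*-congˡ xE≈0) (zeroʳ _))

    negate-minimal : ∀ {c} → IsMinimalDependency E c → IsMinimalDependency E (λ i → - 1# * c i)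
    negate-minimal {c} min = record
      { dependency = λ j →
          trans (·-scaleˡ (- 1#) c (λ i → E i j)) (trans (*-congˡ (dependency j)) (zeroʳ _))
      ; nonempty   = proj₁ nonempty , *-≉0 (sgn≉0 1F) (proj₂ nonempty)
      ; minimal    = λ d ddep d≉0 d⊆ → λ {i} -ci≉0 →
          minimal d ddep d≉0 (λ {k} dk≉0 ck≈0 → d⊆ {k} dk≉0 (trans (*-congˡ ck≈0) (zeroʳ _)))
            {i} (λ ci≈0 → -ci≉0 (trans (*-congˡ ci≈0) (zeroʳ _)))
      }
      where open IsMinimalDependency min

    -- Negating the dependency exchanges the two sides. Acyclicity speaks of an empty `X⁻`; through
    -- this symmetry it also makes `X⁺` nonempty.
    circuits-sym : ∀ {X⁺ X⁻} → circuits E X⁺ X⁻ → circuits E X⁻ X⁺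
    circuits-sym (c , min , pos , neg) = (λ i → - 1# * c i) , negate-minimal min
      , (λ i → mk⇔ (0<-1* ∘ to (neg i)) (from (neg i) ∘ -1*<0))
      , (λ i → mk⇔ (λ i∈ → <-respˡ-≈ (*-comm _ _) (pos-*-neg (to (pos i) i∈) -1<0))
          (from (pos i) ∘ <0-1*))
      where -1<0 = 0<-⇒<0 (<-respʳ-≈ (solve 0 (con 1ℤ := :- :- con 1ℤ) refl) 0<1)

    acyclic⇒nonempty⁻ : Acyclic (circuits E) → ∀ {X⁺ X⁻} → circuits E X⁺ X⁻ → Nonempty X⁻
    acyclic⇒nonempty⁻ acyclic {X⁺} {X⁻} circuit with nonempty? X⁻
    ... | yes nonempty = nonempty
    ... | no empty = contradiction (≡.subst (circuits E X⁺) (Empty-unique empty) circuit)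
        (acyclic X⁺)

    cell⇒transitive : Acyclic (circuits E) → ∀ {ε} → Satisfiable (Cell ε) →
        IsTransitiveColoring (circuits E) ε
    cell⇒transitive acyclic {ε} (x , cell) X⁺ X⁻ circuit@(c , min , pos , neg) =
      let k , ck≉0 = nonempty
          t≉0 = *-≉0 ck≉0 (cell-≉0 ε cell k)
          i , 0<ti = sum≈0⇒pos t ∑t≈0 k t≉0
          j , tj<0 = sum≈0⇒neg t ∑t≈0 k t≉0
      in common i (pos-cancelˡ (cell-pos ε cell i) (<-respʳ-≈ (t≈ i) 0<ti))
                j (neg-cancelˡ (cell-pos ε cell j) (<-respˡ-≈ (t≈ j) tj<0))
      where
      open IsMinimalDependency min
      t : Fin _ → Carrier
      t i = c i * (x · E i)
      ∑t≈0 = dependency-· E dependency x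
      -- The first factor is positive on the cell, so `t i` has the sign of `sgn (ε i) * c i`.
      t≈ : ∀ i → t i ≈ (sgn (ε i) * (x · E i)) * (sgn (ε i) * c i)
      t≈ i = trans (sym (sgn-square (ε i) (t i)))
        (solve 3 (λ s c a → s :* (s :* (c :* a)) := s :* a :* (s :* c)) refl
          (sgn (ε i)) (c i) (x · E i))
      -- If `i` and `j` have the same colour, their coefficients have opposite signs and they
      -- witness the intersection. Otherwise both lie on the same side, which then shows both
      -- colours, so any element of the other side shares a colour with it.
      common : ∀ i → 0# < sgn (ε i) * c i → ∀ j → sgn (ε j) * c j < 0# →
          Image (circuits E) ε X⁺ ≬ Image (circuits E) ε X⁻
      common i 0<si j sj<0 with ε i in εi | ε j in εj
      ... | 0F | 0F = 0F , (i , from (pos i) (1*-pos 0<si) , εi) ,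
          (j , from (neg j) (1*-neg sj<0) , εj)
      ... | 1F | 1F = 1F , (j , from (pos j) (<0-1* sj<0) , εj) ,
          (i , from (neg i) (-1*<0 0<si) , εi)
      ... | 0F | 1F with k , k∈ ← acyclic⇒nonempty⁻ acyclic circuit with ε k in εk
      ...   | 0F = 0F , (i , from (pos i) (1*-pos 0<si) , εi) , (k , k∈ , εk)
      ...   | 1F = 1F , (j , from (pos j) (<0-1* sj<0) , εj) , (k , k∈ , εk)
      common i 0<si j sj<0 | 1F | 0F with k , k∈ ← acyclic⇒nonempty⁻ acyclic (circuits-sym circuit)
                                         with ε k in εk
      ...   | 0F = 0F , (k , k∈ , εk) , (j , from (neg j) (1*-neg sj<0) , εj)
      ...   | 1F = 1F , (k , k∈ , εk) , (i , from (neg i) (-1*<0 0<si) , εi)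

    -- A circuit conforming to `ε` would have a colour `κ` on both sides, and `sgn κ` cannot agree
    -- with a positive and with a negative coefficient.
    transitive⇒cell : ExcludedMiddle 0ℓ → ∀ {ε} → IsTransitiveColoring (circuits E) ε →
        Satisfiable (Cell ε)
    transitive⇒cell em {ε} transitive with gordan-circuit em E (sgn≉0 ∘ ε)
    ... | inj₁ cell = cell
    ... | inj₂ (c , min , conforms)
      with κ , (i , i∈ , εi≡κ) , (j , j∈ , εj≡κ) ←
        transitive _ _ (c , min , ∈-decidableSubset (λ i → 0# <? c i) ,
                            ∈-decidableSubset (λ i → c i <? 0#))
      = contradiction (to (∈-decidableSubset (λ i → c i <? 0#) j) j∈)
          (opposite κ (conformsAt εi≡κ) (conformsAt εj≡κ)
              (to (∈-decidableSubset (λ i → 0# <? c i) i) i∈))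
      where
      conformsAt : ∀ {κ i} → ε i ≡ κ → 0# ≤ sgn κ * c i
      conformsAt {i = i} ≡.refl = conforms i
      opposite : ∀ κ {x y} → 0# ≤ sgn κ * x → 0# ≤ sgn κ * y → 0# < x → ¬ y < 0#
      opposite 0F _ 0≤y _ y<0 = ≤⇒≯ 0≤y (<-respˡ-≈ (sym (*-identityˡ _)) y<0)
      opposite 1F 0≤-x _ 0<x _ = asym 0<x (-1*<0 (≥0∧≉0⇒pos 0≤-x (*-≉0 (sgn≉0 1F) (pos⇒≉0 0<x))))

-- Cells and chambers

module Topology (ℝ : CompleteOrderedField) where

  open CompleteOrderedField ℝ hiding (zero; setoid)
  open OverReals ℝ
  open OrderedField ℝ
  open Duality ℝ
  open IntegerCoefficients commutativeRing

  -- Open half-spaces and connected sets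

  <+⇒∸< : ∀ {x y δ} → x < y + δ → x - y < δ
  <+⇒∸< {x} {y} {δ} p =
      0<∸⇒< (<-respʳ-≈ (solve 3 (λ x y d → y :+ d :- x := d :- (x :- y)) refl x y δ) (<⇒0<∸ p))

  ∸<⇒<+ : ∀ {x y δ} → x - y < δ → x < y + δ
  ∸<⇒<+ {x} {y} {δ} p =
      0<∸⇒< (<-respʳ-≈ (solve 3 (λ x y d → d :- (x :- y) := y :+ d :- x) refl x y δ) (<⇒0<∸ p))

  near-reflexive : ∀ {n δ} {x y : ℝ^ n} → 0# < δ → (∀ j → x j ≈ y j) → Near δ x y
  near-reflexive 0<δ x≈y j =
      ∸<⇒<+ (<-respˡ-≈ (x≈y⇒0≈x-y (x≈y j)) 0<δ) , ∸<⇒<+ (<-respˡ-≈ (x≈y⇒0≈x-y (sym (x≈y j))) 0<δ)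
    where
    x≈y⇒0≈x-y : ∀ {x y} → x ≈ y → 0# ≈ x - y
    x≈y⇒0≈x-y {y = y} x≈y = trans (sym (-‿inverseʳ y)) (+-congʳ (sym x≈y))

  near-sym : ∀ {n δ} {x y : ℝ^ n} → Near δ x y → Near δ y x
  near-sym near j = proj₂ (near j) , proj₁ (near j)

  -- An arbitrary predicate need not respect pointwise equality. An open one does, because points
  -- equal to the centre lie in every cube around it.
  open-resp : ∀ {n} {U : Pred (ℝ^ n) 0ℓ} → Open U → ∀ {x y} → (∀ j → x j ≈ y j) → U x → U y
  open-resp openU x≈y x∈U with δ , 0<δ , ball ← openU _ x∈U = ball _ (near-reflexive 0<δ x≈y)

  -- Induction on the dimension, with half of `ε` for the first coordinate and half for the rest. A
  -- one-sided bound is enough because `Near` is symmetric and `δ` does not depend on the points.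
  ·-continuous : ∀ {n} (e : ℝ^ n) {ε} → 0# < ε → ∃[ δ ] 0# < δ × ∀ x y → Near δ x y →
      x · e < y · e + ε
  ·-continuous {zero} e 0<ε = 1# , 0<1 , λ _ _ _ → <-respʳ-≈ (sym (+-identityˡ _)) 0<ε
  ·-continuous {suc n} e {ε} 0<ε
    with h , 0<h , h+h≈ε ← halve 0<ε
    with η , 0<η , small ← *-small (e zero) 0<h | δ , 0<δ , cont ← ·-continuous (e ∘ suc) 0<h
    with μ , 0<μ , below ← lower-bound₂ 0<η 0<δ
    = μ , 0<μ , λ x y near →
      let x₀-y₀<μ = <+⇒∸< (proj₁ (near zero))
          y₀-x₀<μ = <+⇒∸< (proj₂ (near zero))
          head< = small (x zero - y zero) (proj₁ (below _ x₀-y₀<μ) ,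
            <-respˡ-≈ (solve 2 (λ x y → y :- x := :- (x :- y)) refl (x zero) (y zero))
                (proj₁ (below _ y₀-x₀<μ)))
          tail< = cont (x ∘ suc) (y ∘ suc) λ j →
            ∸<⇒<+ (proj₂ (below _ (<+⇒∸< (proj₁ (near (suc j)))))) ,
            ∸<⇒<+ (proj₂ (below _ (<+⇒∸< (proj₂ (near (suc j))))))
      in 0<∸⇒< (<-respʳ-≈ (trans
        (solve 6 (λ x y e X Y h → h :- (x :- y) :* e :+ (Y :+ h :- X) :=
            y :* e :+ Y :+ (h :+ h) :- (x :* e :+ X)) refl
          (x zero) (y zero) (e zero) ((x ∘ suc) · (e ∘ suc)) ((y ∘ suc) · (e ∘ suc)) h)
        (+-congʳ (+-congˡ h+h≈ε)))
        (+-pos (<⇒0<∸ head<) (<⇒0<∸ tail<)))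

  halfspace⁺-open : ∀ {n} (e : ℝ^ n) → Open (λ x → 0# < x · e)
  halfspace⁺-open e x 0<xe with δ , 0<δ , cont ← ·-continuous e 0<xe = δ , 0<δ , λ y near →
    0<∸⇒< (<-respʳ-≈ (solve 2 (λ a b → b :+ a :- a := b :- con 0ℤ) refl (x · e) (y · e))
        (<⇒0<∸ (cont x y near)))

  halfspace⁻-open : ∀ {n} (e : ℝ^ n) → Open (λ x → x · e < 0#)
  halfspace⁻-open e x xe<0 with δ , 0<δ , cont ← ·-continuous e (<0⇒0<- xe<0) = δ , 0<δ , λ y near →
    <-respʳ-≈ (-‿inverseʳ (x · e)) (cont y x (near-sym near))

  ≉0⇒pos⊎neg : ∀ {x} → x ≉ 0# → 0# < x ⊎ x < 0#
  ≉0⇒pos⊎neg {x} x≉0 with compare 0# x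
  ... | tri< 0<x _ _ = inj₁ 0<x
  ... | tri≈ _ 0≈x _ = contradiction (sym 0≈x) x≉0
  ... | tri> _ _ x<0 = inj₂ x<0

  -- The two open half-spaces cover `D`; if it met both, it would meet their intersection, which is
  -- empty.
  connected-same-side : ∀ {n} {D : Pred (ℝ^ n) 0ℓ} (e : ℝ^ n) →
                        Connected D → (∀ {z} → D z → z · e ≉ 0#) →
                        ∀ {x y} → D x → D y → 0# < x · e → 0# < y · e
  connected-same-side e connected ≉0 {x} {y} x∈D y∈D 0<xe with ≉0⇒pos⊎neg (≉0 y∈D)
  ... | inj₁ 0<ye = 0<ye
  ... | inj₂ ye<0
    with z , _ , 0<ze , ze<0 ← connected _ _ (halfspace⁺-open e) (halfspace⁻-open e)
                                 (≉0⇒pos⊎neg ∘ ≉0) (x , x∈D , 0<xe) (y , y∈D , ye<0)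
    = contradiction ze<0 (asym 0<ze)

  -- Convex sets are connected

  segment : ∀ {n} → ℝ^ n → ℝ^ n → Carrier → ℝ^ n
  segment x y t j = x j + t * (y j + - 1# * x j)

  Convex : ∀ {n} → Pred (Pred (ℝ^ n) 0ℓ) 0ℓ
  Convex A = ∀ {x y} → A x → A y → ∀ t → 0# ≤ t → t ≤ 1# → A (segment x y t)

  positive-convex : ∀ {n m} (v : Fin m → ℝ^ n) → Convex (Positive v)
  positive-convex v {x} {y} posx posy t 0≤t t≤1 i = <-respʳ-≈ (sym seg≈) (pos 0≤t)
    where
    seg≈ : segment x y t · v i ≈ (1# - t) * (x · v i) + t * (y · v i)
    seg≈ = trans (·-linearˡ x t (λ j → y j + - 1# * x j) (v i))
      (trans (+-congˡ (*-congˡ (·-linearˡ y (- 1#) x (v i))))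
        (solve 3 (λ t a b → a :+ t :* (b :+ :- con 1ℤ :* a) := (con 1ℤ :- t) :* a :+ t :* b) refl
            t (x · v i) (y · v i)))
    -- One weight may vanish: for positive `t` the second product is positive, for `t` zero the
    -- first is.
    pos : 0# ≤ t → 0# < (1# - t) * (x · v i) + t * (y · v i)
    pos (inj₁ 0<t) = +-nonneg-pos (*-nonneg (≤⇒0≤∸ t≤1) (inj₁ (posx i))) (*-pos 0<t (posy i))
    pos (inj₂ 0≈t) = <-respʳ-≈ (trans
      (solve 2 (λ a b → a := (con 1ℤ :- con 0ℤ) :* a :+ con 0ℤ :* b) refl (x · v i) (y · v i))
      (+-cong (*-congʳ (+-congˡ (-‿cong 0≈t))) (*-congʳ 0≈t))) (posx i)

  segment-continuous : ∀ {n} (x y : ℝ^ n) {δ} → 0# < δ →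
                       ∃[ η ] 0# < η × ∀ s t → ∣ t - s ∣< η → Near δ (segment x y s) (segment x y t)
  segment-continuous x y 0<δ
    with η , 0<η , small ← *-small-family (λ j → y j + - 1# * x j) (λ _ → 0<δ)
    = η , 0<η , λ s t t-s<η j →
      ∸<⇒<+ (<-respˡ-≈ (solve 4 (λ s t x d → :- (t :- s) :* d := x :+ s :* d :- (x :+ t :* d)) refl
            s t (x j) (y j + - 1# * x j))
        (small (- (t - s)) (∣-∣< t-s<η) j)) ,
      ∸<⇒<+ (<-respˡ-≈ (solve 4 (λ s t x d → (t :- s) :* d := x :+ t :* d :- (x :+ s :* d)) refl
            s t (x j) (y j + - 1# * x j))
        (small (t - s) t-s<η j))

  -- Otherwise `s - η` would be an upper bound below the least one.
  approach-supremum : ExcludedMiddle 0ℓ → ∀ {P : Pred Carrier 0ℓ} {s η} →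
                      (∀ b → UpperBound P b → s ≤ b) → 0# < η → ∃[ t ] P t × s - η < t
  approach-supremum em {P} {s} {η} least 0<η with em {∃[ t ] P t × s - η < t}
  ... | yes found = found
  ... | no ∄ = contradiction s-η<s (≤⇒≯ (least (s - η) λ t t∈P → ≮⇒≥ λ s-η<t → ∄ (t , t∈P , s-η<t)))
    where s-η<s = 0<∸⇒< (<-respʳ-≈ (solve 2 (λ s h → h := s :- (s :- h)) refl s η) 0<η)

  -- Let `s` be the supremum of the parameters whose points on the segment lie in `U`. If the point
  -- at `s` is in `V`, so are nearby points with parameters in `P`, and these are in `U`. If it is
  -- in `U`, then `s` must be 1, as otherwise larger parameters would belong to `P`; the point is
  -- then `y`, which is in `V`.
  convex⇒connected : ExcludedMiddle 0ℓ → ∀ {n} {A : Pred (ℝ^ n) 0ℓ} → Convex A → Connected A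
  convex⇒connected em {A = A} convex U V openU openV cover (x , x∈A , x∈U) (y , y∈A , y∈V) =
      meet (supremum P (0# , P0) (1# , λ t (_ , t≤1 , _) → t≤1))
    where
    p = segment x y
    P : Pred Carrier 0ℓ
    P t = 0# ≤ t × t ≤ 1# × U (p t)
    P0 : P 0#
    P0 = inj₂ refl , inj₁ 0<1 ,
      open-resp openU (λ j → solve 2 (λ x y → x := x :+ con 0ℤ :* (y :+ :- con 1ℤ :* x)) refl
                        (x j) (y j)) x∈U
    meet : ∃[ s ] UpperBound P s × (∀ b → UpperBound P b → s ≤ b) → A ≬ (λ z → U z × V z)
    meet (s , upper , least) = [ in-U , in-V ]′ (cover s∈A)
      where
      0≤s = upper 0# P0
      s≤1 = least 1# λ t (_ , t≤1 , _) → t≤1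
      s∈A = convex x∈A y∈A s 0≤s s≤1
      in-V : V (p s) → A ≬ (λ z → U z × V z)
      in-V s∈V =
        let δ , 0<δ , ball = openV (p s) s∈V
            η , 0<η , near = segment-continuous x y 0<δ
            t , t∈P@(0≤t , t≤1 , t∈U) , s-η<t = approach-supremum em least 0<η
            t-s<η = 0<∸⇒< (<-respʳ-≈ (solve 3 (λ s t η → (s :- t) :+ η := η :- (t :- s)) refl s t η)
                             (+-nonneg-pos (≤⇒0≤∸ (upper t t∈P)) 0<η))
            s-t<η = 0<∸⇒< (<-respʳ-≈
                (solve 3 (λ s t η → t :- (s :- η) := η :- :- (t :- s)) refl s t η) (<⇒0<∸ s-η<t))
        in p t , convex x∈A y∈A t 0≤t t≤1 , t∈U , ball (p t) (near s t (t-s<η , s-t<η))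
      in-U : U (p s) → A ≬ (λ z → U z × V z)
      in-U s∈U with s≤1
      ... | inj₂ s≈1 = p s , s∈A , s∈U , open-resp openV
        (λ j → trans (solve 2 (λ x y → y := x :+ con 1ℤ :* (y :+ :- con 1ℤ :* x)) refl (x j) (y j))
                     (+-congˡ (*-congʳ (sym s≈1)))) y∈V
      ... | inj₁ s<1 =
        let δ , 0<δ , ball = openU (p s) s∈U
            η , 0<η , near = segment-continuous x y 0<δ
            -- A step below `η` stays in `U`, and one below `1# - s` keeps the parameter under 1.
            μ , 0<μ , below = lower-bound₂ 0<η (<⇒0<∸ s<1)
            u , 0<u , u<μ = halfway 0<μ
            u<η , u<1-s = below u u<μ
            t = s + u
            t-s≈u = solve 2 (λ s u → u := s :+ u :- s) refl s u
            0<t = +-nonneg-pos 0≤s 0<u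
            t<1 = <-respˡ-≈ (+-comm u s)
                (0<∸⇒< (<-respʳ-≈ (solve 2 (λ s u → con 1ℤ :- s :- u := con 1ℤ :- (u :+ s)) refl s u)
                  (<⇒0<∸ u<1-s)))
            t-s<η , s-t<η = pos⇒∣∣< 0<u u<η
            t∈P = inj₁ 0<t , inj₁ t<1 ,
              ball (p t) (near s t (<-respˡ-≈ t-s≈u t-s<η , <-respˡ-≈ (-‿cong t-s≈u) s-t<η))
            s<t = 0<∸⇒< (<-respʳ-≈ t-s≈u 0<u)
        in contradiction s<t (≤⇒≯ (upper t t∈P))

  -- Connected components of the complement

  module _ {n m} (E : Fin m → ℝ^ n) where

    open Colorings ℝ

    cell-resp : ∀ ε ε′ → ε ≗ ε′ → Cell E ε ⊆ Cell E ε′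
    cell-resp _ _ ε≗ε′ {x} cell i = ≡.subst (λ κ → 0# < x · (λ j → sgn κ * E i j)) (ε≗ε′ i) (cell i)

    cell-connected : ExcludedMiddle 0ℓ → ∀ ε → Connected (Cell E ε)
    cell-connected em ε = convex⇒connected em (positive-convex (reorient (sgn ∘ ε) E))

    cell⊆complement : ∀ ε → Cell E ε ⊆ Complement E
    cell⊆complement ε cell (i , x⊥Eᵢ) = cell-≉0 E ε cell i x⊥Eᵢ

    connected⊆cell : ∀ {D} ε → D ⊆ Complement E → Connected D → ∀ {x} → D x → Cell E ε x →
        D ⊆ Cell E ε
    connected⊆cell ε D⊆ connected x∈D cell y∈D i =
      connected-same-side (reorient (sgn ∘ ε) E i) connected
        (λ {z} z∈D z⊥ → *-≉0 (sgn≉0 (ε i)) (λ zE≈0 → D⊆ z∈D (i , zE≈0))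
            (trans (sym (·-scaleʳ (sgn (ε i)) z (E i))) z⊥))
        x∈D y∈D (cell i)

    cell-component : ExcludedMiddle 0ℓ → ∀ ε → Satisfiable (Cell E ε) →
        IsConnectedComponent (Complement E) (Cell E ε)
    cell-component em ε (x , cell) = record
      { contained = cell⊆complement ε
      ; nonempty  = x , cell
      ; connected = cell-connected em ε
      ; maximal   = λ D D⊆ connected cell⊆D → connected⊆cell ε D⊆ connected (cell⊆D cell) cell
      }

    color : Carrier → Fin 2
    color a with 0# <? a
    ... | yes _ = 0F
    -- This also colours `0#`, a value that no product takes on the complement.
    ... | no _  = 1F

    sgn-color : ∀ {a} → a ≉ 0# → 0# < sgn (color a) * a
    sgn-color {a} a≉0 with 0# <? a
    ... | yes 0<a = <-respʳ-≈ (sym (*-identityˡ a)) 0<a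
    ... | no 0≮a with ≉0⇒pos⊎neg a≉0
    ...   | inj₁ 0<a = contradiction 0<a 0≮a
    ...   | inj₂ a<0 = 0<-1* a<0

    color-unique : ∀ κ {a} → 0# < sgn κ * a → color a ≡ κ
    color-unique κ {a} p with 0# <? a
    color-unique 0F p | yes _ = ≡.refl
    color-unique 1F p | yes 0<a = contradiction (-1*<0 p) (asym 0<a)
    color-unique 0F p | no 0≮a = contradiction (1*-pos p) 0≮a
    color-unique 1F p | no _ = ≡.refl

    coloringOf : ℝ^ n → Fin m → Fin 2
    coloringOf x i = color (x · E i)

    coloringOf-cell : ∀ {x} → Complement E x → Cell E (coloringOf x) x
    coloringOf-cell {x} x∈ i =
        <-respʳ-≈ (sym (·-scaleʳ (sgn (coloringOf x i)) x (E i)))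
            (sgn-color (λ x⊥Eᵢ → x∈ (i , x⊥Eᵢ)))

    cell⇒coloringOf : ∀ ε {x} → Cell E ε x → coloringOf x ≗ ε
    cell⇒coloringOf ε cell i = color-unique (ε i) (cell-pos E ε cell i)

    -- Connectedness of `C` gives one inclusion; its maximality, applied to the connected cell,
    -- gives the other.
    component≐cell : ExcludedMiddle 0ℓ → ∀ {C x} → IsConnectedComponent (Complement E) C → C x →
                     C ≐ Cell E (coloringOf x)
    component≐cell em {C} {x} component x∈C = C⊆cell ,
        maximal (Cell E ε) (cell⊆complement ε) (cell-connected em ε) C⊆cell
      where
      open IsConnectedComponent component
      ε = coloringOf x
      C⊆cell : C ⊆ Cell E ε
      C⊆cell = connected⊆cell ε contained connected x∈C (coloringOf-cell (contained x∈C))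

    Cells : Setoid 0ℓ 0ℓ
    Cells = On.setoid (Fin m →-setoid Fin 2) (proj₁ {B = λ ε → Satisfiable (Cell E ε)})

    -- A chamber is coloured through the point that witnesses its nonemptiness. Equal chambers may
    -- carry different points, but these lie in one cell, and any point of a cell determines its
    -- coloring.
    cells↔chambers : ExcludedMiddle 0ℓ → Inverse Cells (Chambers E)
    cells↔chambers em = record
      { to        = λ (ε , cell) → Cell E ε , cell-component em ε cell
      ; from      = λ chamber → coloring chamber , point chamber ,
                      coloringOf-cell (contained (proj₂ chamber) (point∈ chamber))
      ; to-cong   = λ {(ε , _)} {(ε′ , _)} ε≗ε′ →
          cell-resp ε ε′ ε≗ε′ , cell-resp ε′ ε (≡.sym ∘ ε≗ε′)
      ; from-cong = λ {chamber} {chamber′} (_ , C′⊆C) i →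
                      ≡.sym (cell⇒coloringOf (coloring chamber)
                          (proj₁ (≐cell chamber) (C′⊆C (point∈ chamber′))) i)
      ; inverse   = (λ {chamber} {(ε , _)} ε≗ →
                        (λ z∈ → proj₂ (≐cell chamber) (cell-resp ε (coloring chamber) ε≗ z∈))
                      , (λ z∈C → cell-resp (coloring chamber) ε (≡.sym ∘ ε≗)
                          (proj₁ (≐cell chamber) z∈C)))
                  , (λ {(ε , _)} {chamber} (C⊆ , _) → cell⇒coloringOf ε (C⊆ (point∈ chamber)))
      }
      where
      open IsConnectedComponent
      Chamber = Setoid.Carrier (Chambers E)
      point : Chamber → ℝ^ n
      point (_ , component) = proj₁ (nonempty component)
      point∈ : ((C , component) : Chamber) → C (point (C , component))
      point∈ (_ , component) = proj₂ (nonempty component)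
      coloring : Chamber → Fin m → Fin 2
      coloring chamber = coloringOf (point chamber)
      ≐cell : (chamber : Chamber) → proj₁ chamber ≐ Cell E (coloring chamber)
      ≐cell chamber = component≐cell em (proj₂ chamber) (point∈ chamber)

-- Counting

private
  variable
    a b ℓ ℓ′ : Level

restrict : (S : Setoid a ℓ) → Pred (Setoid.Carrier S) b → Setoid _ ℓ
restrict S P = On.setoid S (proj₁ {B = P})

restrict-inverse : {S : Setoid a ℓ} {T : Setoid b ℓ′} (f : Inverse S T) →
                   {P : Pred (Setoid.Carrier T) 0ℓ} → P Respects Setoid._≈_ T →
                   Inverse (restrict S (P ∘ Inverse.to f)) (restrict T P)
restrict-inverse {T = T} f resp = record
  { to        = λ (x , p) → to x , p
  ; from      = λ (y , p) → from y , resp (Setoid.sym T (strictlyInverseˡ y)) p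
  ; to-cong   = to-cong
  ; from-cong = from-cong
  ; inverse   = inverseˡ , inverseʳ
  }
  where open Inverse f

restrict-⇔ : (S : Setoid a ℓ) {P Q : Pred (Setoid.Carrier S) 0ℓ} → (∀ {x} → P x ⇔ Q x) →
             Inverse (restrict S P) (restrict S Q)
restrict-⇔ S P⇔Q = record
  { to        = λ (x , p) → x , Equivalence.to P⇔Q p
  ; from      = λ (x , q) → x , Equivalence.from P⇔Q q
  ; to-cong   = id
  ; from-cong = id
  ; inverse   = id , id
  }

-- The elements of `P` are enumerated in increasing order. The restricted setoid ignores membership
-- proofs, so each element counts once.
finite-subset : ∀ {n} {P : Pred (Fin n) 0ℓ} → Decidable P →
    ∃[ k ] restrict (≡.setoid (Fin n)) P HasCardinality k
finite-subset {zero} P? = 0 , record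
  { to = λ () ; from = λ () ; to-cong = λ {} ; from-cong = λ {} ; inverse = (λ {}) , λ {} }
finite-subset {suc n} {P} P? with k , f ← finite-subset (P? ∘ suc) with P? zero
... | no ¬p0 = k , record
  { to        = λ i → suc (proj₁ (to i)) , proj₂ (to i)
  ; from      = from′
  ; to-cong   = ≡.cong suc ∘ to-cong
  ; from-cong = λ {i} {j} → from′-cong i j
  ; inverse   = (λ {i} → from′-inverseˡ i) , λ {_} {i} → from′-inverseʳ i
  }
  where
  open Inverse f
  from′ : ∃ P → Fin k
  from′ (zero , p)  = contradiction p ¬p0
  from′ (suc i , p) = from (i , p)
  from′-cong : ∀ i j → proj₁ i ≡ proj₁ j → from′ i ≡ from′ j
  from′-cong (zero , p) _ _ = contradiction p ¬p0
  from′-cong (suc _ , _) (suc _ , _) i≡j = from-cong (suc-injective i≡j)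
  from′-inverseˡ : ∀ i {x} → x ≡ from′ i → suc (proj₁ (to x)) ≡ proj₁ i
  from′-inverseˡ (zero , p) _ = contradiction p ¬p0
  from′-inverseˡ (suc i , p) eq = ≡.cong suc (inverseˡ eq)
  from′-inverseʳ : ∀ i {x} → proj₁ i ≡ suc (proj₁ (to x)) → from′ i ≡ x
  from′-inverseʳ (suc i , p) eq = inverseʳ (suc-injective eq)
... | yes p0 = suc k , record
  { to        = to′
  ; from      = from′
  ; to-cong   = ≡.cong (proj₁ ∘ to′)
  ; from-cong = λ {i} {j} → from′-cong i j
  ; inverse   = (λ {i} → from′-inverseˡ i) , λ {x} {i} → from′-inverseʳ i x
  }
  where
  open Inverse f
  to′ : Fin (suc k) → ∃ P
  to′ zero    = zero , p0
  to′ (suc x) = suc (proj₁ (to x)) , proj₂ (to x)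
  from′ : ∃ P → Fin (suc k)
  from′ (zero , p)  = zero
  from′ (suc i , p) = suc (from (i , p))
  from′-cong : ∀ i j → proj₁ i ≡ proj₁ j → from′ i ≡ from′ j
  from′-cong (zero , _) (zero , _) _ = ≡.refl
  from′-cong (suc _ , _) (suc _ , _) i≡j = ≡.cong suc (from-cong (suc-injective i≡j))
  from′-inverseˡ : ∀ i {x} → x ≡ from′ i → proj₁ (to′ x) ≡ proj₁ i
  from′-inverseˡ (zero , p) ≡.refl = ≡.refl
  from′-inverseˡ (suc i , p) ≡.refl = ≡.cong suc (strictlyInverseˡ (i , p))
  from′-inverseʳ : ∀ i x → proj₁ i ≡ proj₁ (to′ x) → from′ i ≡ x
  from′-inverseʳ (zero , p) zero _ = ≡.refl
  from′-inverseʳ (suc i , p) (suc x) eq = ≡.cong suc (inverseʳ (suc-injective eq))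

functions-finite : ∀ m c → (Fin m →-setoid Fin c) HasCardinality (c ^ m)
functions-finite m c = record
  { to        = finToFun
  ; from      = funToFin
  ; to-cong   = λ i≡j x → ≡.cong (λ i → finToFun i x) i≡j
  ; from-cong = funToFin-cong
  ; inverse   = (λ { ≡.refl → finToFun-funToFin _ }) , λ eq →
      ≡.trans (funToFin-cong eq) (funToFin-finToFin {m} {c} _)
  }
  where
  -- Colorings are compared pointwise, so the code of a function must be shown to depend on its
  -- values alone.
  funToFin-cong : ∀ {m c} {f g : Fin m → Fin c} → f ≗ g → funToFin f ≡ funToFin g
  funToFin-cong {zero} f≗g = ≡.refl
  funToFin-cong {suc m} f≗g = ≡.cong₂ combine (f≗g zero) (funToFin-cong (f≗g ∘ suc))

restrict-finite : ∀ {n} (S : Setoid a ℓ) → S HasCardinality n → {P : Pred (Setoid.Carrier S) 0ℓ} →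
                  P Respects Setoid._≈_ S → Decidable P → ∃[ k ] restrict S P HasCardinality k
restrict-finite S f resp P? = let k , g = finite-subset (P? ∘ Inverse.to f) in
  k , Composition.inverse g (restrict-inverse f resp)

theorem1p17 : ExcludedMiddle 0ℓ → (ℝ : CompleteOrderedField) →
    let open OverReals ℝ in
    (n m : ℕ) (E : Fin m → ℝ^ n) → Acyclic (circuits E) →
    ∃[ k ] (TransitiveColorings (circuits E) 2 HasCardinality k) × (Chambers E HasCardinality k)
theorem1p17 em ℝ n m E acyclic =
  k , Composition.inverse f (restrict-⇔ (Fin m →-setoid Fin 2) cell⇔transitive)
    , Composition.inverse f (cells↔chambers E em)
  where
  open OverReals ℝ
  open Colorings ℝ
  open Topology ℝ
  -- Excluded middle decides which of the `2 ^ m` cells are nonempty; both sides are then compared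
  -- with this one enumeration.
  counted : ∃[ k ] Cells E HasCardinality k
  counted = restrict-finite (Fin m →-setoid Fin 2) (functions-finite m 2)
    (λ {ε} {ε′} ε≗ε′ (x , cell) → x , cell-resp E ε ε′ ε≗ε′ cell) (λ _ → em)
  k = proj₁ counted
  f = proj₂ counted
  cell⇔transitive : ∀ {ε} → Satisfiable (Cell E ε) ⇔ IsTransitiveColoring (circuits E) ε
  cell⇔transitive = mk⇔ (cell⇒transitive E acyclic) (transitive⇒cell E em)
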